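{- For every positive integer $n$, there exists a covering path of $G_n^2$ whose link length equals the minimum link length of a covering trail of $G_n^2$. Moreover, if $n=2m$ for some positive integer $m$, then there exists a covering cycle of $G_n^2$ whose link length equals the minimum link length of a covering trail of $G_n^2$.
   Context: For a positive integer $n$, let $G_n^2=\{0,1,\ldots,n-1\}\times\{0,1,\ldots,n-1\}\subset\mathbb{R}^2$. A covering trail of $G_n^2$ is a directed polygonal chain in $\mathbb{R}^2$ (a finite sequence of points, consecutive ones joined by line segments called edges) that passes through every point of $G_n^2$ at least once, in which no edge is repeated and no two consecutive edges are collinear; its vertices need not be grid points. A covering path is a covering trail that passes through each point of $G_n^2$ exactly once (points not in $G_n^2$ may be passed through several times). A covering circuit is a covering trail whose starting point equals its endpoint. A covering cycle is a closed covering path, i.e. a covering circuit (possibly self-crossing) in which every point of $G_n^2$ is passed through exactly once, except that the starting point, if it is a grid point, is counted both at the start and at the end. The link length of a trail is its number of edges. It is known that the minimum link length of a covering trail of $G_n^2$ is $1$ for $n=1$, $3$ for $n=2$, and $2(n-1)$ for $n\ge 3$. -}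

module Defs where

open import Data.Nat using (ℕ; zero; suc; _<_) renaming (_*_ to _*ℕ_)
open import Data.Integer using (+_)
open import Data.Rational using (ℚ; 0ℚ; _/_; _+_; _*_; _-_; _≤_)
open import Data.Fin using (Fin; zero; suc; inject₁; fromℕ; toℕ)
open import Data.Product using (Σ; ∃; _×_; _,_)
open import Data.Sum using (_⊎_)
open import Relation.Binary.PropositionalEquality using (_≡_; _≢_)

Point : Set
Point = ℚ × ℚ

ℕtoℚ : ℕ → ℚ
ℕtoℚ a = + a / 1

gridPt : ℕ → ℕ → Point
gridPt a b = ℕtoℚ a , ℕtoℚ b

_-ᵖ_ : Point → Point → Point
(a , b) -ᵖ (c , d) = (a - c) , (b - d)

cross : Point → Point → ℚ
cross (a , b) (c , d) = a * d - b * c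

dot : Point → Point → ℚ
dot (a , b) (c , d) = a * c + b * d

OnSeg : Point → Point → Point → Set
OnSeg p q x = (cross (q -ᵖ p) (x -ᵖ p) ≡ 0ℚ) × (dot (x -ᵖ p) (x -ᵖ q) ≤ 0ℚ)

OnHalfOpen : Point → Point → Point → Set
OnHalfOpen p q x = OnSeg p q x × (x ≢ q)

-- A polygonal chain with k edges (link length k): vertices v 0 , … , v k.
Chain : ℕ → Set
Chain k = Fin (suc k) → Point

module _ {k : ℕ} (v : Chain k) where

  start end : Point
  start = v zero
  end   = v (fromℕ k)

  src tgt : Fin k → Point
  src i = v (inject₁ i)
  tgt i = v (suc i)

  -- the chain passes through x "on edge i" (counting each edge half-open,
  -- so a shared vertex is counted once, for the edge leaving it)
  PassesOnEdge : Point → Fin k → Set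
  PassesOnEdge x i = OnHalfOpen (src i) (tgt i) x

  PassesThrough : Point → Set
  PassesThrough x = (Σ (Fin k) λ i → PassesOnEdge x i) ⊎ (x ≡ end)

  SameSegment : Fin k → Fin k → Set
  SameSegment i j = ((src i ≡ src j) × (tgt i ≡ tgt j))
                  ⊎ ((src i ≡ tgt j) × (tgt i ≡ src j))

  IsTrail : Set
  IsTrail = (∀ i → src i ≢ tgt i)
          × (∀ i j → SameSegment i j → i ≡ j)
          × (∀ i j → toℕ j ≡ suc (toℕ i)
               → cross (tgt i -ᵖ src i) (tgt j -ᵖ src j) ≢ 0ℚ)

  Covers : ℕ → Set
  Covers n = ∀ a b → a < n → b < n → PassesThrough (gridPt a b)

  IsCoveringTrail : ℕ → Set
  IsCoveringTrail n = IsTrail × Covers n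

  IsCoveringPath : ℕ → Set
  IsCoveringPath n = IsCoveringTrail n
    × (∀ a b → a < n → b < n →
         (∀ i j → PassesOnEdge (gridPt a b) i → PassesOnEdge (gridPt a b) j → i ≡ j)
       × (∀ i → PassesOnEdge (gridPt a b) i → gridPt a b ≢ end))

  IsCoveringCircuit : ℕ → Set
  IsCoveringCircuit n = IsCoveringTrail n × (start ≡ end)

  -- closed covering path: the start point (= end point) is counted only once,
  -- which the half-open edge counting does automatically
  IsCoveringCycle : ℕ → Set
  IsCoveringCycle n = IsCoveringCircuit n
    × (∀ a b → a < n → b < n →
         ∀ i j → PassesOnEdge (gridPt a b) i → PassesOnEdge (gridPt a b) j → i ≡ j)

-- The known minimum link length of a covering trail of G_n^2 (given in the context):
-- 1 for n = 1, 3 for n = 2, 2(n-1) for n ≥ 3.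
minTrailLength : ℕ → ℕ
minTrailLength zero = zero
minTrailLength (suc zero) = 1
minTrailLength (suc (suc zero)) = 3
minTrailLength (suc (suc (suc m))) = 2 *ℕ suc (suc m)

{-# OPTIONS --safe #-}
module Submission where

-- Idea, for n ≥ 5. Write n = 3 + m + c with c = m (n odd) or c = m + 1 (n even). All rows
-- other than c and c + 1 are traversed by horizontal edges that overshoot the grid on both
-- sides. Rows c and c + 1 are covered by n slanted edges, each through one point of either
-- row; they are so flat that they have left the grid before reaching the next row, hence
-- they can lead to any of the horizontal edges without meeting further grid points. The
-- exceptions are a rising and a falling edge that meet just below row c, and, just above
-- row c + 1, the first edge, together with the last one when n is even, which closes the
-- chain. No vertex is a grid point. The grids with n ≤ 4 are checked by computation.

-- With `n` slanted and only `n - 2` horizontal edges, a closed chain that never joins two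
-- horizontal edges has exactly two vertices at which slanted edges meet; an open chain that starts
-- and ends slanted has one. A slanted edge moves about n / 2 columns per row, enough to leave the
-- grid within one more row, except at four ends: the upper ends of the first edge and of the last
-- edge of an even grid, and the lower ends of the pair that meets below row c. Prolonged by one
-- row, each of these would hit another grid point, so it stops before that row, at a non-integral
-- height. In an even grid the four ends meet in two pairs, which gives precisely the two vertices
-- required by the count. Every chain uses two rows above row c + 1, whence m is at least 1 and n at
-- least 5.

open import Defs
open import Data.Nat as ℕ using (ℕ; zero; suc; z≤n; s≤s)
import Data.Nat.Properties as ℕ
import Data.Nat.Tactic.RingSolver as ℕ-Ring
open import Data.Nat.Coprimality as Coprime using (1-coprimeTo)
import Data.Integer as ℤ
import Data.Integer.Properties as ℤ
open import Data.Rational as ℚ using (ℚ; 0ℚ; 1ℚ; mkℚ; _/_; -_; *≤*; *<*; positive; negative; nonNegative; nonPositive; ≢-nonZero; Positive; ↥_; 1/_)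
import Data.Rational.Properties as ℚ
open import Data.Rational.Solver using (module +-*-Solver)
open import Data.Fin using (Fin; toℕ; fromℕ<)
import Data.Fin.Properties as Fin
open import Data.Vec using (_∷_; []; lookup)
open import Data.Product using (Σ; ∃; _×_; _,_; proj₁; proj₂)
import Data.Product.Properties as Product
open import Data.Sum as Sum using (_⊎_; inj₁; inj₂; [_,_]′)
open import Data.Unit using (⊤; tt)
open import Function using (_∘_)
open import Relation.Binary.Definitions using (DecidableEquality)
open import Relation.Binary.PropositionalEquality
open import Relation.Nullary using (Dec; ¬_; yes; no; contradiction)
open import Relation.Nullary.Decidable using (toWitness; map′; ¬?; _×-dec_; _⊎-dec_; _→-dec_)
open +-*-Solver using (solve; _:+_; _:*_; _:-_; :-_; con; _:=_)

-- Rational plane geometry: the embedding of ℕ, segments, slanted and horizontal lines.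

module RationalPlane where

  open import Data.Integer using (+_)
  open import Data.Rational using (_+_; _*_; _-_; _≤_; _<_)

  <⇒≱ : ∀ {p q} → p < q → ¬ (q ≤ p)
  <⇒≱ p<q q≤p = ℚ.<-irrefl refl (ℚ.<-≤-trans p<q q≤p)

  ι : ℕ → ℚ
  ι = ℕtoℚ

  -- `+ a / 1` normalises through a gcd that is stuck on a variable `a`. The explicit `mkℚ` form
  -- exposes numerator and denominator, and the lemmas on `ι` rewrite to it.
  ι-mkℚ : ∀ a → ι a ≡ mkℚ (+ a) 0 (Coprime.sym (1-coprimeTo a))
  ι-mkℚ a = ℚ.normalize-coprime (Coprime.sym (1-coprimeTo a))

  ι-+ : ∀ a b → ι (a ℕ.+ b) ≡ ι a + ι b
  ι-+ a b rewrite ι-mkℚ a | ι-mkℚ b | ℤ.*-identityʳ (+ a) | ℤ.*-identityʳ (+ b) = refl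

  ι-* : ∀ a b → ι (a ℕ.* b) ≡ ι a * ι b
  ι-* a b rewrite ι-mkℚ a | ι-mkℚ b | sym (ℤ.pos-* a b) = refl

  ι-injective : ∀ {a b} → ι a ≡ ι b → a ≡ b
  ι-injective {a} {b} eq rewrite ι-mkℚ a | ι-mkℚ b = ℤ.+-injective (cong ↥_ eq)

  ι-mono-≤ : ∀ {a b} → a ℕ.≤ b → ι a ≤ ι b
  ι-mono-≤ {a} {b} a≤b rewrite ι-mkℚ a | ι-mkℚ b =
    *≤* (subst₂ ℤ._≤_ (sym (ℤ.*-identityʳ (+ a))) (sym (ℤ.*-identityʳ (+ b))) (ℤ.+≤+ a≤b))

  ι-mono-< : ∀ {a b} → a ℕ.< b → ι a < ι b
  ι-mono-< {a} {b} a<b rewrite ι-mkℚ a | ι-mkℚ b =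
    *<* (subst₂ ℤ._<_ (sym (ℤ.*-identityʳ (+ a))) (sym (ℤ.*-identityʳ (+ b))) (ℤ.+<+ a<b))

  ι-cancel-< : ∀ {a b} → ι a < ι b → a ℕ.< b
  ι-cancel-< {a} {b} a<b = ℕ.≰⇒> λ b≤a → <⇒≱ a<b (ι-mono-≤ b≤a)

  0≤ι : ∀ a → 0ℚ ≤ ι a
  0≤ι a = ι-mono-≤ {0} {a} z≤n

  *≡0⇒≡0 : ∀ {p q} → p ≢ 0ℚ → p * q ≡ 0ℚ → q ≡ 0ℚ
  *≡0⇒≡0 {p} {q} p≢0 pq≡0 = begin
    q                ≡⟨ ℚ.*-identityˡ q ⟨
    1ℚ * q           ≡⟨ cong (_* q) (ℚ.*-inverseˡ p) ⟨
    1/ p * p * q     ≡⟨ ℚ.*-assoc (1/ p) p q ⟩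
    1/ p * (p * q)   ≡⟨ cong (1/ p *_) pq≡0 ⟩
    1/ p * 0ℚ        ≡⟨ ℚ.*-zeroʳ (1/ p) ⟩
    0ℚ               ∎
    where
    open ≡-Reasoning
    instance _ = ≢-nonZero p≢0

  *-≢0 : ∀ {p q} → p ≢ 0ℚ → q ≢ 0ℚ → p * q ≢ 0ℚ
  *-≢0 p≢0 q≢0 = q≢0 ∘ *≡0⇒≡0 p≢0

  -≡0⇒≡ : ∀ {p q} → p - q ≡ 0ℚ → p ≡ q
  -≡0⇒≡ {p} {q} eq = begin
    p            ≡⟨ solve 2 (λ p q → p := (p :- q) :+ q) refl p q ⟩
    (p - q) + q  ≡⟨ cong (_+ q) eq ⟩
    0ℚ + q       ≡⟨ ℚ.+-identityˡ q ⟩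
    q            ∎
    where open ≡-Reasoning

  <⇒-≢0 : ∀ {p q} → p < q → q - p ≢ 0ℚ
  <⇒-≢0 p<q eq = ℚ.<⇒≢ p<q (sym (-≡0⇒≡ eq))

  p≤q⇒p-q≤0 : ∀ {p q} → p ≤ q → p - q ≤ 0ℚ
  p≤q⇒p-q≤0 {p} {q} p≤q = subst (p - q ≤_) (ℚ.+-inverseʳ q) (ℚ.+-monoˡ-≤ (- q) p≤q)

  p<q⇒p-q<0 : ∀ {p q} → p < q → p - q < 0ℚ
  p<q⇒p-q<0 {p} {q} p<q = subst (p - q <_) (ℚ.+-inverseʳ q) (ℚ.+-monoˡ-< (- q) p<q)

  p≤q⇒0≤q-p : ∀ {p q} → p ≤ q → 0ℚ ≤ q - p
  p≤q⇒0≤q-p {p} {q} p≤q = subst (_≤ q - p) (ℚ.+-inverseʳ p) (ℚ.+-monoˡ-≤ (- p) p≤q)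

  p<q⇒0<q-p : ∀ {p q} → p < q → 0ℚ < q - p
  p<q⇒0<q-p {p} {q} p<q = subst (_< q - p) (ℚ.+-inverseʳ p) (ℚ.+-monoˡ-< (- p) p<q)

  0≤p² : ∀ p → 0ℚ ≤ p * p
  0≤p² p with ℚ.≤-total 0ℚ p
  ... | inj₁ 0≤p = ℚ.nonNegative⁻¹ (p * p) {{ℚ.nonNeg*nonNeg⇒nonNeg p {{nonNegative 0≤p}} p {{nonNegative 0≤p}}}}
  ... | inj₂ p≤0 = ℚ.nonNegative⁻¹ (p * p) {{ℚ.nonPos*nonPos⇒nonPos p {{nonPositive p≤0}} p {{nonPositive p≤0}}}}

  between-on : ∀ {lo x hi} → lo ≤ x → x ≤ hi → (x - lo) * (x - hi) ≤ 0ℚ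
  between-on {lo} {x} {hi} lo≤x x≤hi = ℚ.nonPositive⁻¹ _ {{ℚ.nonNeg*nonPos⇒nonPos
    (x - lo) {{nonNegative (p≤q⇒0≤q-p lo≤x)}} (x - hi) {{nonPositive (p≤q⇒p-q≤0 x≤hi)}}}}

  -- Outside the interval both factors have the same strict sign, which makes the product positive.
  between-off : ∀ {lo x hi} → lo ≤ hi → (x - lo) * (x - hi) ≤ 0ℚ → lo ≤ x × x ≤ hi
  between-off {lo} {x} {hi} lo≤hi h =
    ℚ.≮⇒≥ (λ x<lo → <⇒≱ (neg*neg (p<q⇒p-q<0 x<lo) (p<q⇒p-q<0 (ℚ.<-≤-trans x<lo lo≤hi))) h) ,
    ℚ.≮⇒≥ (λ hi<x → <⇒≱ (pos*pos (p<q⇒0<q-p (ℚ.≤-<-trans lo≤hi hi<x)) (p<q⇒0<q-p hi<x)) h)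
    where
    neg*neg : ∀ {p q} → p < 0ℚ → q < 0ℚ → 0ℚ < p * q
    neg*neg {p} {q} p<0 q<0 = ℚ.positive⁻¹ _ {{ℚ.neg*neg⇒pos p {{negative p<0}} q {{negative q<0}}}}
    pos*pos : ∀ {p q} → 0ℚ < p → 0ℚ < q → 0ℚ < p * q
    pos*pos {p} {q} 0<p 0<q = ℚ.positive⁻¹ _ {{ℚ.pos*pos⇒pos p {{positive 0<p}} q {{positive 0<q}}}}

  OnSeg-sym : ∀ p q x → OnSeg p q x → OnSeg q p x
  OnSeg-sym (p₁ , p₂) (q₁ , q₂) (x₁ , x₂) (on , btw) =
    (begin
      cross ((p₁ , p₂) -ᵖ (q₁ , q₂)) ((x₁ , x₂) -ᵖ (q₁ , q₂))
        ≡⟨ solve 6 (λ p₁ p₂ q₁ q₂ x₁ x₂ →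
             (p₁ :- q₁) :* (x₂ :- q₂) :- (p₂ :- q₂) :* (x₁ :- q₁)
             := :- ((q₁ :- p₁) :* (x₂ :- p₂) :- (q₂ :- p₂) :* (x₁ :- p₁))) refl p₁ p₂ q₁ q₂ x₁ x₂ ⟩
      - cross ((q₁ , q₂) -ᵖ (p₁ , p₂)) ((x₁ , x₂) -ᵖ (p₁ , p₂)) ≡⟨ cong -_ on ⟩
      0ℚ ∎) ,
    subst (_≤ 0ℚ) (cong₂ _+_ (ℚ.*-comm (x₁ - p₁) (x₁ - q₁)) (ℚ.*-comm (x₂ - p₂) (x₂ - q₂))) btw
    where open ≡-Reasoning

  OnSeg-refl : ∀ p q → OnSeg p q p
  OnSeg-refl (p₁ , p₂) (q₁ , q₂) =
    solve 4 (λ p₁ p₂ q₁ q₂ → (q₁ :- p₁) :* (p₂ :- p₂) :- (q₂ :- p₂) :* (p₁ :- p₁) := con 0ℚ) refl p₁ p₂ q₁ q₂ ,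
    ℚ.≤-reflexive (solve 4 (λ p₁ p₂ q₁ q₂ → (p₁ :- p₁) :* (p₁ :- q₁) :+ (p₂ :- p₂) :* (p₂ :- q₂) := con 0ℚ) refl p₁ p₂ q₁ q₂)

  squares≤0⇒≡0 : ∀ {p q} → p * p + q * q ≤ 0ℚ → p ≡ 0ℚ
  squares≤0⇒≡0 {p} {q} h with p ℚ.≟ 0ℚ
  ... | yes p≡0 = p≡0
  ... | no p≢0 = contradiction (ℚ.≤-antisym p²≤0 (0≤p² p)) (*-≢0 p≢0 p≢0)
    where
    p²≤0 : p * p ≤ 0ℚ
    p²≤0 = ℚ.≤-trans (subst (_≤ p * p + q * q) (ℚ.+-identityʳ (p * p)) (ℚ.+-monoʳ-≤ (p * p) (0≤p² q))) h

  -- For equal ends the dot product is a sum of two squares.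
  OnSeg-degenerate : ∀ p x → OnSeg p p x → x ≡ p
  OnSeg-degenerate (p₁ , p₂) (x₁ , x₂) (_ , h) = cong₂ _,_
    (-≡0⇒≡ (squares≤0⇒≡0 {x₁ - p₁} {x₂ - p₂} h))
    (-≡0⇒≡ (squares≤0⇒≡0 {x₂ - p₂} {x₁ - p₁}
      (subst (_≤ 0ℚ) (ℚ.+-comm ((x₁ - p₁) * (x₁ - p₁)) ((x₂ - p₂) * (x₂ - p₂))) h)))

  -- The point at height `s` above row `c` on the line that crosses row `c` in column `x` and moves
  -- `k` columns per row. The inverse slope is used because it is an integer for all lines of the
  -- construction.
  slantPt : ℚ → ℚ → ℚ → ℚ → Point
  slantPt x k c s = x + k * s , c + s

  -- The cross product factors as `(s₂ - s₁) * (x + k * (b - c) - a)`. On the line the dot product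
  -- is `1 + k * k` times the product of the height differences, so only heights remain to be
  -- compared.
  slant-off : ∀ x k c s₁ s₂ a b → s₁ < s₂ → OnSeg (slantPt x k c s₁) (slantPt x k c s₂) (a , b) →
              a ≡ x + k * (b - c) × s₁ ≤ b - c × b - c ≤ s₂
  slant-off x k c s₁ s₂ a b s₁<s₂ (on , btw) = a≡ , between-off (ℚ.<⇒≤ s₁<s₂) prod≤0
    where
    open ≡-Reasoning
    a≡ : a ≡ x + k * (b - c)
    a≡ = sym (-≡0⇒≡ (*≡0⇒≡0 (<⇒-≢0 s₁<s₂) (begin
      (s₂ - s₁) * (x + k * (b - c) - a)
        ≡⟨ solve 7 (λ x k c s₁ s₂ a b →
             (s₂ :- s₁) :* (x :+ k :* (b :- c) :- a)
             := ((x :+ k :* s₂) :- (x :+ k :* s₁)) :* (b :- (c :+ s₁))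
                :- ((c :+ s₂) :- (c :+ s₁)) :* (a :- (x :+ k :* s₁))) refl x k c s₁ s₂ a b ⟩
      cross (slantPt x k c s₂ -ᵖ slantPt x k c s₁) ((a , b) -ᵖ slantPt x k c s₁) ≡⟨ on ⟩
      0ℚ ∎)))
    w = 1ℚ + k * k
    instance
      w-pos : Positive w
      w-pos = ℚ.pos+nonNeg⇒pos 1ℚ (k * k) {{nonNegative (0≤p² k)}}
    prod≤0 : (b - c - s₁) * (b - c - s₂) ≤ 0ℚ
    prod≤0 = ℚ.*-cancelˡ-≤-pos w (subst₂ _≤_ (begin
      dot ((a , b) -ᵖ slantPt x k c s₁) ((a , b) -ᵖ slantPt x k c s₂)
        ≡⟨ cong (λ a → dot ((a , b) -ᵖ slantPt x k c s₁) ((a , b) -ᵖ slantPt x k c s₂)) a≡ ⟩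
      _ ≡⟨ solve 6 (λ x k c s₁ s₂ b →
             ((x :+ k :* (b :- c)) :- (x :+ k :* s₁)) :* ((x :+ k :* (b :- c)) :- (x :+ k :* s₂))
               :+ (b :- (c :+ s₁)) :* (b :- (c :+ s₂))
             := (con 1ℚ :+ k :* k) :* ((b :- c :- s₁) :* (b :- c :- s₂))) refl x k c s₁ s₂ b ⟩
      w * ((b - c - s₁) * (b - c - s₂)) ∎) (sym (ℚ.*-zeroʳ w)) btw)

  slant-on : ∀ x k c s₁ s₂ a b → a ≡ x + k * (b - c) → s₁ ≤ b - c → b - c ≤ s₂ →
             OnSeg (slantPt x k c s₁) (slantPt x k c s₂) (a , b)
  slant-on x k c s₁ s₂ _ b refl s₁≤ ≤s₂ =
    solve 6 (λ x k c s₁ s₂ b →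
      ((x :+ k :* s₂) :- (x :+ k :* s₁)) :* (b :- (c :+ s₁))
        :- ((c :+ s₂) :- (c :+ s₁)) :* ((x :+ k :* (b :- c)) :- (x :+ k :* s₁))
      := con 0ℚ) refl x k c s₁ s₂ b ,
    subst₂ _≤_ (solve 6 (λ x k c s₁ s₂ b →
             (con 1ℚ :+ k :* k) :* ((b :- c :- s₁) :* (b :- c :- s₂))
             := ((x :+ k :* (b :- c)) :- (x :+ k :* s₁)) :* ((x :+ k :* (b :- c)) :- (x :+ k :* s₂))
               :+ (b :- (c :+ s₁)) :* (b :- (c :+ s₂))) refl x k c s₁ s₂ b)
      (ℚ.*-zeroʳ w) (ℚ.*-monoˡ-≤-nonNeg w {{ℚ.pos⇒nonNeg w}} (between-on s₁≤ ≤s₂))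
    where
    w = 1ℚ + k * k
    instance
      w-pos : Positive w
      w-pos = ℚ.pos+nonNeg⇒pos 1ℚ (k * k) {{nonNegative (0≤p² k)}}

  level-off : ∀ p q x → proj₁ p < proj₁ q → proj₂ p ≡ proj₂ q → OnSeg p q x → proj₂ x ≡ proj₂ q
  level-off (x₁ , y) (x₂ , .y) (a , b) x₁<x₂ refl (on , _) = -≡0⇒≡ (*≡0⇒≡0 (<⇒-≢0 x₁<x₂) (trans
    (solve 5 (λ x₁ x₂ y a b → (x₂ :- x₁) :* (b :- y)
       := (x₂ :- x₁) :* (b :- y) :- (y :- y) :* (a :- x₁)) refl x₁ x₂ y a b) on))

  level-on : ∀ p q x → proj₂ p ≡ proj₂ q → proj₁ p ≤ proj₁ x → proj₁ x ≤ proj₁ q → proj₂ x ≡ proj₂ q → OnSeg p q x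
  level-on (x₁ , y) (x₂ , .y) (a , .y) refl x₁≤a a≤x₂ refl =
    solve 4 (λ x₁ x₂ y a → (x₂ :- x₁) :* (y :- y) :- (y :- y) :* (a :- x₁) := con 0ℚ) refl x₁ x₂ y a ,
    subst (_≤ 0ℚ) (solve 4 (λ x₁ x₂ y a → (a :- x₁) :* (a :- x₂)
       := (a :- x₁) :* (a :- x₂) :+ (y :- y) :* (y :- y)) refl x₁ x₂ y a) (between-on x₁≤a a≤x₂)

  turn-into-level : ∀ p q r → proj₂ p ≢ proj₂ q → proj₁ q < proj₁ r → proj₂ q ≡ proj₂ r →
                    cross (q -ᵖ p) (r -ᵖ q) ≢ 0ℚ
  turn-into-level (x₁ , y₁) (x₂ , y) (x₃ , .y) y₁≢y x₂<x₃ refl eq = *-≢0 (y₁≢y ∘ -≡0⇒≡) (<⇒-≢0 x₂<x₃) (trans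
    (solve 5 (λ x₁ y₁ x₂ x₃ y → (y₁ :- y) :* (x₃ :- x₂)
       := (x₂ :- x₁) :* (y :- y) :- (y :- y₁) :* (x₃ :- x₂)) refl x₁ y₁ x₂ x₃ y) eq)

  turn-from-level : ∀ p q r → proj₁ p < proj₁ q → proj₂ p ≡ proj₂ q → proj₂ q ≢ proj₂ r →
                    cross (q -ᵖ p) (r -ᵖ q) ≢ 0ℚ
  turn-from-level (x₁ , y) (x₂ , .y) (x₃ , y₃) x₁<x₂ refl y≢y₃ eq = *-≢0 (<⇒-≢0 x₁<x₂) (y≢y₃ ∘ sym ∘ -≡0⇒≡) (trans
    (solve 5 (λ x₁ x₂ x₃ y y₃ → (x₂ :- x₁) :* (y₃ :- y)
       := (x₂ :- x₁) :* (y₃ :- y) :- (y :- y) :* (x₃ :- x₂)) refl x₁ x₂ x₃ y y₃) eq)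

  -- Serves the one inner vertex at which two slanted edges meet. The columns `x` and `x′` cancel,
  -- leaving a product of three nonzero differences.
  turn-between-slants : ∀ x k x′ k′ c s₁ s₂ s₃ → s₁ ≢ s₂ → s₂ ≢ s₃ → k ≢ k′ →
    cross (slantPt x k c s₂ -ᵖ slantPt x k c s₁) (slantPt x′ k′ c s₃ -ᵖ slantPt x′ k′ c s₂) ≢ 0ℚ
  turn-between-slants x k x′ k′ c s₁ s₂ s₃ s₁≢s₂ s₂≢s₃ k≢k′ eq =
    *-≢0 (*-≢0 (s₁≢s₂ ∘ sym ∘ -≡0⇒≡) (s₂≢s₃ ∘ sym ∘ -≡0⇒≡)) (k≢k′ ∘ -≡0⇒≡) (trans
    (solve 8 (λ x k x′ k′ c s₁ s₂ s₃ → (s₂ :- s₁) :* (s₃ :- s₂) :* (k :- k′)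
       := ((x :+ k :* s₂) :- (x :+ k :* s₁)) :* ((c :+ s₃) :- (c :+ s₂))
          :- ((c :+ s₂) :- (c :+ s₁)) :* ((x′ :+ k′ :* s₃) :- (x′ :+ k′ :* s₂))) refl x k x′ k′ c s₁ s₂ s₃) eq)

  -- Slanted lines with integral data and the grid points on them.

  rise fall : ℕ → ℕ → ℕ → ℚ → Point
  rise x k c = slantPt (ι x) (ι k) (ι c)
  fall x k c = slantPt (ι x) (- ι k) (ι c)

  ι-+* : ∀ a k c → ι (a ℕ.+ k ℕ.* c) ≡ ι a + ι k * ι c
  ι-+* a k c = trans (ι-+ a (k ℕ.* c)) (cong (_+_ (ι a)) (ι-* k c))

  -- Moving `k * c` to the left removes the subtraction, so the line equation can be read in ℕ even
  -- for rows below `c`.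
  rise-eq⇒ : ∀ a b x k c → ι a ≡ ι x + ι k * (ι b - ι c) → a ℕ.+ k ℕ.* c ≡ x ℕ.+ k ℕ.* b
  rise-eq⇒ a b x k c eq = ι-injective {a ℕ.+ k ℕ.* c} {x ℕ.+ k ℕ.* b} (begin
    ι (a ℕ.+ k ℕ.* c)                         ≡⟨ ι-+* a k c ⟩
    ι a + ι k * ι c                           ≡⟨ cong (_+ ι k * ι c) eq ⟩
    ι x + ι k * (ι b - ι c) + ι k * ι c
      ≡⟨ solve 4 (λ x k b c → x :+ k :* (b :- c) :+ k :* c := x :+ k :* b) refl (ι x) (ι k) (ι b) (ι c) ⟩
    ι x + ι k * ι b                           ≡⟨ ι-+* x k b ⟨
    ι (x ℕ.+ k ℕ.* b)                         ∎)
    where open ≡-Reasoning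

  rise-eq⇐ : ∀ a b x k c → a ℕ.+ k ℕ.* c ≡ x ℕ.+ k ℕ.* b → ι a ≡ ι x + ι k * (ι b - ι c)
  rise-eq⇐ a b x k c eq = begin
    ι a                              ≡⟨ solve 2 (λ a q → a := (a :+ q) :- q) refl (ι a) (ι k * ι c) ⟩
    ι a + ι k * ι c - ι k * ι c      ≡⟨ cong (_- ι k * ι c) (ι-+* a k c) ⟨
    ι (a ℕ.+ k ℕ.* c) - ι k * ι c    ≡⟨ cong (λ z → ι z - ι k * ι c) eq ⟩
    ι (x ℕ.+ k ℕ.* b) - ι k * ι c    ≡⟨ cong (_- ι k * ι c) (ι-+* x k b) ⟩
    ι x + ι k * ι b - ι k * ι c
      ≡⟨ solve 4 (λ x k b c → x :+ k :* b :- k :* c := x :+ k :* (b :- c)) refl (ι x) (ι k) (ι b) (ι c) ⟩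
    ι x + ι k * (ι b - ι c)          ∎
    where open ≡-Reasoning

  -- Exchanging `b` and `c` turns a falling line into a rising one; the two lemmas on `fall` thereby
  -- reduce to those on `rise`.
  fall-swap : ∀ x k b c → x + - k * (b - c) ≡ x + k * (c - b)
  fall-swap = solve 4 (λ x k b c → x :+ (:- k) :* (b :- c) := x :+ k :* (c :- b)) refl

  fall-eq⇒ : ∀ a b x k c → ι a ≡ ι x + - ι k * (ι b - ι c) → a ℕ.+ k ℕ.* b ≡ x ℕ.+ k ℕ.* c
  fall-eq⇒ a b x k c eq = rise-eq⇒ a c x k b (trans eq (fall-swap (ι x) (ι k) (ι b) (ι c)))

  fall-eq⇐ : ∀ a b x k c → a ℕ.+ k ℕ.* b ≡ x ℕ.+ k ℕ.* c → ι a ≡ ι x + - ι k * (ι b - ι c)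
  fall-eq⇐ a b x k c eq = trans (rise-eq⇐ a c x k b eq) (sym (fall-swap (ι x) (ι k) (ι b) (ι c)))

  Hit : ℕ → ℕ → ℕ → ℕ → ℕ → Set
  Hit c x y a b = (b ≡ c × a ≡ x) ⊎ (b ≡ suc c × a ≡ y)

  -- From row `c + 2` on, the column is at least `x + k * 2`; below row `c` it would be at most
  -- `x - k`. Each side is excluded in one of two ways: the row is out of reach, or the column is
  -- outside the grid.
  rise-hit : ∀ {n x k c a b} → a ℕ.< n → (b ℕ.< 2 ℕ.+ c) ⊎ (n ℕ.≤ x ℕ.+ k ℕ.* 2) → (c ℕ.≤ b) ⊎ (x ℕ.< k) →
             a ℕ.+ k ℕ.* c ≡ x ℕ.+ k ℕ.* b → Hit c x (x ℕ.+ k) a b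
  rise-hit {n} {x} {k} {c} {a} {b} a<n hi lo eq with ℕ.≤-total c b
  ... | inj₁ c≤b with ℕ.m≤n⇒∃[o]m+o≡n c≤b
  ...   | e , refl = above e hi (ℕ.+-cancelʳ-≡ (k ℕ.* c) a (x ℕ.+ k ℕ.* e) (trans eq (expand x k c e)))
    where
    expand : ∀ x k c e → x ℕ.+ k ℕ.* (c ℕ.+ e) ≡ x ℕ.+ k ℕ.* e ℕ.+ k ℕ.* c
    expand = ℕ-Ring.solve-∀
    above : ∀ e → (c ℕ.+ e ℕ.< 2 ℕ.+ c) ⊎ (n ℕ.≤ x ℕ.+ k ℕ.* 2) → a ≡ x ℕ.+ k ℕ.* e → Hit c x (x ℕ.+ k) a (c ℕ.+ e)
    above 0 _ a≡ = inj₁ (ℕ.+-identityʳ c , trans a≡ (trans (cong (x ℕ.+_) (ℕ.*-zeroʳ k)) (ℕ.+-identityʳ x)))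
    above 1 _ a≡ = inj₂ (ℕ.+-comm c 1 , trans a≡ (cong (x ℕ.+_) (ℕ.*-identityʳ k)))
    above (suc (suc e)) (inj₁ lt) a≡ = contradiction (ℕ.+-cancelʳ-< c (2 ℕ.+ e) 2 (subst (ℕ._< 2 ℕ.+ c) (ℕ.+-comm c (2 ℕ.+ e)) lt)) λ { (s≤s (s≤s ())) }
    above (suc (suc e)) (inj₂ n≤) a≡ = contradiction
      (ℕ.≤-trans n≤ (ℕ.≤-trans (ℕ.+-monoʳ-≤ x (ℕ.*-monoʳ-≤ k (ℕ.m≤m+n 2 e))) (ℕ.≤-reflexive (sym a≡)))) (ℕ.<⇒≱ a<n)
  rise-hit {n} {x} {k} {c} {a} {b} a<n hi lo eq | inj₂ b≤c with ℕ.m≤n⇒m<n∨m≡n b≤c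
  ... | inj₂ refl = inj₁ (refl , ℕ.+-cancelʳ-≡ (k ℕ.* c) a x eq)
  ... | inj₁ b<c with lo
  ...   | inj₁ c≤b = contradiction c≤b (ℕ.<⇒≱ b<c)
  ...   | inj₂ x<k with ℕ.m≤n⇒∃[o]m+o≡n b<c
  ...     | e , refl = contradiction (ℕ.≤-trans (ℕ.m≤m+n k (a ℕ.+ k ℕ.* e)) (ℕ.≤-reflexive
              (ℕ.+-cancelʳ-≡ (k ℕ.* b) _ x (trans (expand a k b e) eq)))) (ℕ.<⇒≱ x<k)
    where
    expand : ∀ a k b e → k ℕ.+ (a ℕ.+ k ℕ.* e) ℕ.+ k ℕ.* b ≡ a ℕ.+ k ℕ.* (suc b ℕ.+ e)
    expand = ℕ-Ring.solve-∀

  -- Mirror image of `rise-hit`: the line leaves the grid on the left above row `c + 1` and on the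
  -- right below row `c`.
  fall-hit : ∀ {n x y k c a b} → a ℕ.< n → x ≡ y ℕ.+ k → (b ℕ.< 2 ℕ.+ c) ⊎ (x ℕ.< k ℕ.* 2) → (c ℕ.≤ b) ⊎ (n ℕ.≤ x ℕ.+ k) →
             a ℕ.+ k ℕ.* b ≡ x ℕ.+ k ℕ.* c → Hit c x y a b
  fall-hit {n} {x} {y} {k} {c} {a} {b} a<n x≡ hi lo eq with ℕ.≤-total c b
  ... | inj₁ c≤b with ℕ.m≤n⇒∃[o]m+o≡n c≤b
  ...   | e , refl = above e hi (ℕ.+-cancelʳ-≡ (k ℕ.* c) (a ℕ.+ k ℕ.* e) x (trans (sym (expand a k c e)) eq))
    where
    expand : ∀ x k c e → x ℕ.+ k ℕ.* (c ℕ.+ e) ≡ x ℕ.+ k ℕ.* e ℕ.+ k ℕ.* c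
    expand = ℕ-Ring.solve-∀
    above : ∀ e → (c ℕ.+ e ℕ.< 2 ℕ.+ c) ⊎ (x ℕ.< k ℕ.* 2) → a ℕ.+ k ℕ.* e ≡ x → Hit c x y a (c ℕ.+ e)
    above 0 _ a≡ = inj₁ (ℕ.+-identityʳ c , trans (sym (trans (cong (a ℕ.+_) (ℕ.*-zeroʳ k)) (ℕ.+-identityʳ a))) a≡)
    above 1 _ a≡ = inj₂ (ℕ.+-comm c 1 , ℕ.+-cancelʳ-≡ k a y (trans (cong (a ℕ.+_) (sym (ℕ.*-identityʳ k))) (trans a≡ x≡)))
    above (suc (suc e)) (inj₁ lt) a≡ = contradiction (ℕ.+-cancelʳ-< c (2 ℕ.+ e) 2 (subst (ℕ._< 2 ℕ.+ c) (ℕ.+-comm c (2 ℕ.+ e)) lt)) λ { (s≤s (s≤s ())) }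
    above (suc (suc e)) (inj₂ x<) a≡ = contradiction
      (ℕ.≤-trans (ℕ.*-monoʳ-≤ k (ℕ.m≤m+n 2 e)) (ℕ.≤-trans (ℕ.m≤n+m _ a) (ℕ.≤-reflexive a≡))) (ℕ.<⇒≱ x<)
  fall-hit {n} {x} {y} {k} {c} {a} {b} a<n x≡ hi lo eq | inj₂ b≤c with ℕ.m≤n⇒m<n∨m≡n b≤c
  ... | inj₂ refl = inj₁ (refl , ℕ.+-cancelʳ-≡ (k ℕ.* c) a x eq)
  ... | inj₁ b<c with lo
  ...   | inj₁ c≤b = contradiction c≤b (ℕ.<⇒≱ b<c)
  ...   | inj₂ n≤ with ℕ.m≤n⇒∃[o]m+o≡n b<c
  ...     | e , refl = contradiction (ℕ.≤-trans n≤ (ℕ.≤-trans (ℕ.m≤m+n (x ℕ.+ k) (k ℕ.* e)) (ℕ.≤-reflexive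
              (sym (ℕ.+-cancelʳ-≡ (k ℕ.* b) a _ (trans eq (expand x k b e))))))) (ℕ.<⇒≱ a<n)
    where
    expand : ∀ x k b e → x ℕ.+ k ℕ.* (suc b ℕ.+ e) ≡ x ℕ.+ k ℕ.+ k ℕ.* e ℕ.+ k ℕ.* b
    expand = ℕ-Ring.solve-∀

  -- This and `above-minus-one` turn the rational height of an end of an edge into the row condition
  -- of `rise-hit` and `fall-hit`.
  below-two : ∀ {hi} b c → hi < ι 2 → ι b - ι c ≤ hi → b ℕ.< 2 ℕ.+ c
  below-two {hi} b c hi<2 ≤hi = ι-cancel-< {b} {2 ℕ.+ c} (subst₂ _<_
    (solve 2 (λ b c → b :- c :+ c := b) refl (ι b) (ι c)) (sym (ι-+ 2 c))
    (ℚ.+-monoˡ-< (ι c) (ℚ.≤-<-trans ≤hi hi<2)))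

  above-minus-one : ∀ {lo} b c → - ι 1 < lo → lo ≤ ι b - ι c → c ℕ.≤ b
  above-minus-one {lo} b c -1<lo lo≤ = ℕ.s≤s⁻¹ (ι-cancel-< {c} {suc b} (subst₂ _<_
    (solve 1 (λ c → :- con (ι 1) :+ (con (ι 1) :+ c) := c) refl (ι c))
    (trans (solve 2 (λ b c → b :- c :+ (con (ι 1) :+ c) := con (ι 1) :+ b) refl (ι b) (ι c)) (sym (ι-+ 1 b)))
    (ℚ.+-monoˡ-< (ι 1 + ι c) (ℚ.<-≤-trans -1<lo lo≤))))

  -- The two bounds make an edge reach rows `c` and `c + 1`, so it contains both of its grid points
  -- wherever it ends. The exact ends matter only for excluding further grid points.
  module _ {lo hi : ℚ} (lo≤0 : lo ≤ 0ℚ) (1≤hi : ι 1 ≤ hi) where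

    lo<hi : lo < hi
    lo<hi = ℚ.≤-<-trans lo≤0 (ℚ.<-≤-trans (ι-mono-< {0} {1} (s≤s z≤n)) 1≤hi)

    private
      spans-c : ∀ c → lo ≤ ι c - ι c × ι c - ι c ≤ hi
      spans-c c = subst (λ z → lo ≤ z × z ≤ hi) (sym (ℚ.+-inverseʳ (ι c)))
        (lo≤0 , ℚ.≤-trans (0≤ι 1) 1≤hi)

      spans-1+c : ∀ c → lo ≤ ι (suc c) - ι c × ι (suc c) - ι c ≤ hi
      spans-1+c c = subst (λ z → lo ≤ z × z ≤ hi)
        (sym (trans (cong (_- ι c) (ι-+ 1 c)) (solve 1 (λ c → con (ι 1) :+ c :- c := con (ι 1)) refl (ι c))))
        (ℚ.≤-trans lo≤0 (0≤ι 1) , 1≤hi)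

    rise-off : ∀ {n} x k c a b → a ℕ.< n → hi < ι 2 ⊎ n ℕ.≤ x ℕ.+ k ℕ.* 2 → - ι 1 < lo ⊎ x ℕ.< k →
               OnSeg (rise x k c lo) (rise x k c hi) (gridPt a b) → Hit c x (x ℕ.+ k) a b
    rise-off {n} x k c a b a<n hi-cond lo-cond on =
      let a≡ , lo≤ , ≤hi = slant-off (ι x) (ι k) (ι c) lo hi (ι a) (ι b) lo<hi on in
      rise-hit a<n ([ (λ h → inj₁ (below-two b c h ≤hi)) , inj₂ ]′ hi-cond)
        ([ (λ h → inj₁ (above-minus-one b c h lo≤)) , inj₂ ]′ lo-cond) (rise-eq⇒ a b x k c a≡)

    rise-on : ∀ x k c a b → Hit c x (x ℕ.+ k) a b → OnSeg (rise x k c lo) (rise x k c hi) (gridPt a b)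
    rise-on x k c a b (inj₁ (refl , refl)) =
      let p , q = spans-c c in slant-on (ι x) (ι k) (ι c) lo hi (ι x) (ι c) (rise-eq⇐ x c x k c refl) p q
    rise-on x k c a b (inj₂ (refl , refl)) =
      let p , q = spans-1+c c in slant-on (ι x) (ι k) (ι c) lo hi (ι (x ℕ.+ k)) (ι (suc c)) (rise-eq⇐ (x ℕ.+ k) (suc c) x k c (shift x k c)) p q
      where
      shift : ∀ x k c → x ℕ.+ k ℕ.+ k ℕ.* c ≡ x ℕ.+ k ℕ.* suc c
      shift = ℕ-Ring.solve-∀

    fall-off : ∀ {n} x y k c a b → x ≡ y ℕ.+ k → a ℕ.< n → hi < ι 2 ⊎ x ℕ.< k ℕ.* 2 → - ι 1 < lo ⊎ n ℕ.≤ x ℕ.+ k →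
               OnSeg (fall x k c lo) (fall x k c hi) (gridPt a b) → Hit c x y a b
    fall-off {n} x y k c a b x≡ a<n hi-cond lo-cond on =
      let a≡ , lo≤ , ≤hi = slant-off (ι x) (- ι k) (ι c) lo hi (ι a) (ι b) lo<hi on in
      fall-hit a<n x≡ ([ (λ h → inj₁ (below-two b c h ≤hi)) , inj₂ ]′ hi-cond)
        ([ (λ h → inj₁ (above-minus-one b c h lo≤)) , inj₂ ]′ lo-cond) (fall-eq⇒ a b x k c a≡)

    fall-on : ∀ x y k c a b → x ≡ y ℕ.+ k → Hit c x y a b → OnSeg (fall x k c lo) (fall x k c hi) (gridPt a b)
    fall-on x y k c a b _ (inj₁ (refl , refl)) =
      let p , q = spans-c c in slant-on (ι x) (- ι k) (ι c) lo hi (ι x) (ι c) (fall-eq⇐ x c x k c refl) p q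
    fall-on x y k c a b refl (inj₂ (refl , refl)) =
      let p , q = spans-1+c c in slant-on (ι x) (- ι k) (ι c) lo hi (ι y) (ι (suc c)) (fall-eq⇐ y (suc c) x k c (shift y k c)) p q
      where
      shift : ∀ y k c → y ℕ.+ k ℕ.* suc c ≡ y ℕ.+ k ℕ.+ k ℕ.* c
      shift = ℕ-Ring.solve-∀

  -- This and the next three place vertices at column 0 or to its left, or at column `n` or to its
  -- right, so that the horizontal edges between them span the grid.
  rise-right : ∀ {n} x k s → n ℕ.≤ x ℕ.+ k ℕ.* s → ι n ≤ ι x + ι k * ι s
  rise-right {n} x k s n≤ = subst (ι n ≤_) (ι-+* x k s) (ι-mono-≤ n≤)

  fall-right : ∀ {n} x k s → n ℕ.≤ x ℕ.+ k ℕ.* s → ι n ≤ ι x + - ι k * - ι s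
  fall-right {n} x k s n≤ = subst (ι n ≤_)
    (solve 3 (λ x k s → x :+ k :* s := x :+ (:- k) :* (:- s)) refl (ι x) (ι k) (ι s)) (rise-right x k s n≤)

  fall-left : ∀ x k s → x ℕ.≤ k ℕ.* s → ι x + - ι k * ι s ≤ 0ℚ
  fall-left x k s x≤ = subst (_≤ 0ℚ)
    (trans (cong (_-_ (ι x)) (ι-* k s)) (solve 3 (λ x k s → x :- k :* s := x :+ (:- k) :* s) refl (ι x) (ι k) (ι s)))
    (p≤q⇒p-q≤0 (ι-mono-≤ x≤))

  rise-left : ∀ x k s → x ℕ.≤ k ℕ.* s → ι x + ι k * - ι s ≤ 0ℚ
  rise-left x k s x≤ = subst (_≤ 0ℚ)
    (solve 3 (λ x k s → x :+ (:- k) :* s := x :+ k :* (:- s)) refl (ι x) (ι k) (ι s)) (fall-left x k s x≤)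

  row-above : ∀ b c s → ι b ≡ ι c + ι s → b ≡ c ℕ.+ s
  row-above b c s eq = ι-injective {b} {c ℕ.+ s} (trans eq (sym (ι-+ c s)))

  row-below : ∀ b c s → ι b ≡ ι c + - ι s → b ℕ.+ s ≡ c
  row-below b c s eq = ι-injective {b ℕ.+ s} {c} (trans (ι-+ b s) (trans (cong (_+ ι s) eq)
    (solve 2 (λ c s → c :+ (:- s) :+ s := c) refl (ι c) (ι s))))

  row-below⁻¹ : ∀ b c s → b ℕ.+ s ≡ c → ι b ≡ ι c + - ι s
  row-below⁻¹ b _ s refl = sym (trans (cong (_+ - ι s) (ι-+ b s))
    (solve 2 (λ b s → b :+ s :+ (:- s) := b) refl (ι b) (ι s)))

open RationalPlane

-- From a sequence of vertices to covering paths and cycles.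

module Tours where

  open import Data.Nat using (_≤_; _<_)

  -- `Passes` uses closed segments, so `unique` also keeps grid points off the inner vertices. With
  -- a grid point on every edge, it further makes edges nondegenerate and pairwise distinct.
  -- Indexing by ℕ keeps `inject₁` and `fromℕ` out of the construction.
  record GridTour (n K : ℕ) (V : ℕ → Point) : Set where

    Passes : ℕ → ℕ → ℕ → Set
    Passes i a b = OnSeg (V i) (V (suc i)) (gridPt a b)

    field
      cover      : ∀ a b → a < n → b < n → ∃ λ i → i < K × Passes i a b
      unique     : ∀ i j a b → i < K → j < K → a < n → b < n → Passes i a b → Passes j a b → i ≡ j
      inhabited  : ∀ i → i < K → ∃ λ a → ∃ λ b → a < n × b < n × Passes i a b
      turn       : ∀ i → suc i < K → cross (V (suc i) -ᵖ V i) (V (suc (suc i)) -ᵖ V (suc i)) ≢ 0ℚ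
      start∉grid : ∀ a b → gridPt a b ≢ V 0
      end∉grid   : ∀ a b → gridPt a b ≢ V K

    chain : Chain K
    chain i = V (toℕ i)

    private
      src≡ : ∀ i → src chain i ≡ V (toℕ i)
      src≡ i = cong V (Fin.toℕ-inject₁ i)

      end≡ : end chain ≡ V K
      end≡ = cong V (Fin.toℕ-fromℕ K)

      -- A grid point at an inner vertex would lie on two consecutive edges.
      vertex∉grid : ∀ i a b → i ≤ K → a < n → b < n → gridPt a b ≢ V i
      vertex∉grid zero a b _ a<n b<n = start∉grid a b
      vertex∉grid (suc i) a b i<K a<n b<n eq with ℕ.m≤n⇒m<n∨m≡n i<K
      ... | inj₂ refl = end∉grid a b eq
      ... | inj₁ 1+i<K = ℕ.1+n≢n (sym (unique i (suc i) a b i<K 1+i<K a<n b<n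
        (subst (OnSeg (V i) (V (suc i))) (sym eq) (OnSeg-sym (V (suc i)) (V i) (V (suc i)) (OnSeg-refl (V (suc i)) (V i))))
        (subst (OnSeg (V (suc i)) (V (suc (suc i)))) (sym eq) (OnSeg-refl (V (suc i)) (V (suc (suc i)))))))

      passes⇒ : ∀ {x} i → PassesOnEdge chain x i → OnSeg (V (toℕ i)) (V (suc (toℕ i))) x
      passes⇒ {x} i (on , _) = subst (λ p → OnSeg p (V (suc (toℕ i))) x) (src≡ i) on

      -- The grid point on a degenerate edge would be a vertex.
      segment≢ : ∀ i → i < K → V i ≢ V (suc i)
      segment≢ i i<K eq with inhabited i i<K
      ... | a , b , a<n , b<n , on = vertex∉grid i a b (ℕ.<⇒≤ i<K) a<n b<n
        (OnSeg-degenerate (V i) (gridPt a b) (subst (λ q → OnSeg (V i) q (gridPt a b)) (sym eq) on))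

      sameSegment : ∀ i j → SameSegment chain i j → i ≡ j
      sameSegment i j same with inhabited (toℕ i) (Fin.toℕ<n i)
      ... | a , b , a<n , b<n , on = Fin.toℕ-injective
        (unique (toℕ i) (toℕ j) a b (Fin.toℕ<n i) (Fin.toℕ<n j) a<n b<n on (transfer same))
        where
        x = gridPt a b
        transfer : SameSegment chain i j → OnSeg (V (toℕ j)) (V (suc (toℕ j))) x
        transfer (inj₁ (s , t)) = subst₂ (λ p q → OnSeg p q x) (trans (sym (src≡ i)) (trans s (src≡ j))) t on
        transfer (inj₂ (s , t)) = OnSeg-sym (V (suc (toℕ j))) (V (toℕ j)) x
          (subst₂ (λ p q → OnSeg p q x) (trans (sym (src≡ i)) s) (trans t (src≡ j)) on)

      turning : ∀ i j → toℕ j ≡ suc (toℕ i) → cross (tgt chain i -ᵖ src chain i) (tgt chain j -ᵖ src chain j) ≢ 0ℚ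
      turning i j eq rewrite src≡ i | src≡ j | eq = turn (toℕ i) (subst (_< K) eq (Fin.toℕ<n j))

      coveringTrail : IsCoveringTrail chain n
      coveringTrail = ((λ i eq → segment≢ (toℕ i) (Fin.toℕ<n i) (trans (sym (src≡ i)) eq)) , sameSegment , turning) , covers
        where
        covers : Covers chain n
        covers a b a<n b<n with cover a b a<n b<n
        ... | i , i<K , on = inj₁ (k , subst (λ p → OnSeg p (tgt chain k) (gridPt a b)) (sym (src≡ k))
                (subst (λ i → OnSeg (V i) (V (suc i)) (gridPt a b)) (sym toℕk≡i) on) ,
              -- A half-open edge omits its target, which is no grid point.
              vertex∉grid (suc (toℕ k)) a b (Fin.toℕ<n k) a<n b<n)
          where
          k = fromℕ< i<K
          toℕk≡i = Fin.toℕ-fromℕ< i<K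

      once : ∀ a b → a < n → b < n → ∀ i j →
             PassesOnEdge chain (gridPt a b) i → PassesOnEdge chain (gridPt a b) j → i ≡ j
      once a b a<n b<n i j p q = Fin.toℕ-injective (unique (toℕ i) (toℕ j) a b
        (Fin.toℕ<n i) (Fin.toℕ<n j) a<n b<n (passes⇒ i p) (passes⇒ j q))

    coveringPath : IsCoveringPath chain n
    coveringPath = coveringTrail , λ a b a<n b<n → once a b a<n b<n ,
      λ _ _ eq → end∉grid a b (trans eq end≡)

    coveringCycle : V 0 ≡ V K → IsCoveringCycle chain n
    coveringCycle closed = (coveringTrail , trans closed (sym end≡)) , once

open Tours

-- Combinatorics: the order of the edges and the edge that owns each grid point.

module EdgeLabels where

  open import Data.Nat using (_+_; _*_; _∸_; _≤_; _<_)

  -- Comparison with `m` that returns `a` or `a - m` and carries no proof, so that `split-<` and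
  -- `split-+` can rewrite it inside `owner`.
  split : ℕ → ℕ → ℕ ⊎ ℕ
  split zero a = inj₂ a
  split (suc m) zero = inj₁ zero
  split (suc m) (suc a) = Sum.map₁ suc (split m a)

  split-< : ∀ {m a} → a < m → split m a ≡ inj₁ a
  split-< {suc m} {zero} _ = refl
  split-< {suc m} {suc a} (s≤s a<m) = cong (Sum.map₁ suc) (split-< a<m)

  split-+ : ∀ m r → split m (r + m) ≡ inj₂ r
  split-+ zero r = cong inj₂ (ℕ.+-identityʳ r)
  split-+ (suc m) r rewrite ℕ.+-suc r m = cong (Sum.map₁ suc) (split-+ m r)

  <⊎+ : ∀ m a → a < m ⊎ ∃ λ r → a ≡ r + m
  <⊎+ m a with ℕ.<-≤-connex a m
  ... | inj₁ a<m = inj₁ a<m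
  ... | inj₂ m≤a = inj₂ (a ∸ m , sym (ℕ.m∸n+n≡m m≤a))

  -- The horizontal edges low j and upp j lie on rows c − 1 − j and c + 2 + j; ascB and desB
  -- are the slanted edges meeting below row c, and ascA is the first edge.
  data Label : Set where
    ascA ascB desB : Label
    asc des low upp : ℕ → Label

  -- Rising lines are run downwards, falling lines upwards, and all rows from left to right. The
  -- pair `ascB`, `desB` inserted between `upp 0` and `upp 1` shifts the index of the later upper
  -- rows by one.
  next : Label → Label
  next ascA          = low 0
  next (low j)       = des j
  next (des zero)    = upp 0
  next (des (suc j)) = upp (2 + j)
  next (upp zero)    = ascB
  next ascB          = desB
  next desB          = upp 1
  next (upp (suc j)) = asc j
  next (asc j)       = low (suc j)

  labelAt : ℕ → Label
  labelAt zero    = ascA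
  labelAt (suc i) = next (labelAt i)

  -- Seven edges precede `asc 0`; each further round has four, and the recursion matches four
  -- applications of `next`.
  posAsc : ℕ → ℕ
  posAsc zero    = 7
  posAsc (suc j) = 4 + posAsc j

  pos : Label → ℕ
  pos ascA                = 0
  pos (low zero)          = 1
  pos (des zero)          = 2
  pos (upp zero)          = 3
  pos ascB                = 4
  pos desB                = 5
  pos (upp (suc zero))    = 6
  pos (asc j)             = posAsc j
  pos (low (suc j))       = 1 + posAsc j
  pos (des (suc j))       = 2 + posAsc j
  pos (upp (suc (suc j))) = 3 + posAsc j

  pos-next : ∀ d → pos (next d) ≡ suc (pos d)
  pos-next ascA                = refl
  pos-next (low zero)          = refl
  pos-next (low (suc j))       = refl
  pos-next (des zero)          = refl
  pos-next (des (suc j))       = refl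
  pos-next (upp zero)          = refl
  pos-next ascB                = refl
  pos-next desB                = refl
  pos-next (upp (suc zero))    = refl
  pos-next (upp (suc (suc j))) = refl
  pos-next (asc j)             = refl

  pos-labelAt : ∀ i → pos (labelAt i) ≡ i
  pos-labelAt zero    = refl
  pos-labelAt (suc i) = trans (pos-next (labelAt i)) (cong suc (pos-labelAt i))

  labelAt-posAsc : ∀ j → labelAt (posAsc j) ≡ asc j
  labelAt-posAsc zero    = refl
  labelAt-posAsc (suc j) = cong (next ∘ next ∘ next ∘ next) (labelAt-posAsc j)

  -- With `pos-labelAt` this makes labels and indices interchangeable, so all case analysis can be
  -- done on labels.
  labelAt-pos : ∀ d → labelAt (pos d) ≡ d
  labelAt-pos ascA                = refl
  labelAt-pos (low zero)          = refl
  labelAt-pos (des zero)          = refl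
  labelAt-pos (upp zero)          = refl
  labelAt-pos ascB                = refl
  labelAt-pos desB                = refl
  labelAt-pos (upp (suc zero))    = refl
  labelAt-pos (asc j)             = labelAt-posAsc j
  labelAt-pos (low (suc j))       = cong next (labelAt-posAsc j)
  labelAt-pos (des (suc j))       = cong (next ∘ next) (labelAt-posAsc j)
  labelAt-pos (upp (suc (suc j))) = cong (next ∘ next ∘ next) (labelAt-posAsc j)

  posAsc≡ : ∀ j → posAsc j ≡ 7 + 4 * j
  posAsc≡ zero = refl
  posAsc≡ (suc j) = trans (cong (4 +_) (posAsc≡ j)) (shift j)
    where
    shift : ∀ j → 4 + (7 + 4 * j) ≡ 7 + 4 * suc j
    shift = ℕ-Ring.solve-∀

  -- `e` encodes the parity: n is odd for `e = 0` and even for `e = 1`.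
  module Labels (m′ e : ℕ) (e≤1 : e ≤ 1) where

    m c n K : ℕ
    m = suc m′
    c = e + m
    n = 3 + (m + c)
    K = 2 * (2 + (m + c))

    m≤c : m ≤ c
    m≤c = ℕ.m≤n+m m e

    c≤1+m : c ≤ suc m
    c≤1+m = ℕ.+-monoˡ-≤ m e≤1

    Valid : Label → Set
    Valid (asc j) = j < m
    Valid (des j) = j < c
    Valid (low j) = j < c
    Valid (upp j) = j ≤ m
    Valid _       = ⊤

    K≤ : ∀ {w} → m + c ≤ w → K ≤ 2 * (2 + w)
    K≤ le = ℕ.*-monoʳ-≤ 2 (ℕ.+-monoʳ-≤ 2 le)

    K≥ : ∀ {w} → w ≤ m + c → 2 * (2 + w) ≤ K
    K≥ le = ℕ.*-monoʳ-≤ 2 (ℕ.+-monoʳ-≤ 2 le)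

    K≥8 : 8 ≤ K
    K≥8 = K≥ {2} (ℕ.+-mono-≤ {1} {m} (s≤s z≤n) (ℕ.≤-trans (s≤s z≤n) m≤c))

    -- By contraposition: an index beyond its bound forces `m + c`, hence `K`, to be too small for
    -- the position.
    pos<K⇒valid : ∀ d → pos d < K → Valid d
    pos<K⇒valid ascA _ = tt
    pos<K⇒valid ascB _ = tt
    pos<K⇒valid desB _ = tt
    pos<K⇒valid (low zero) _ = ℕ.≤-trans (s≤s z≤n) m≤c
    pos<K⇒valid (des zero) _ = ℕ.≤-trans (s≤s z≤n) m≤c
    pos<K⇒valid (upp zero) _ = z≤n
    pos<K⇒valid (upp (suc zero)) _ = s≤s z≤n
    pos<K⇒valid (asc j) lt = ℕ.≰⇒> λ m≤j → ℕ.<⇒≱ lt (begin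
      K                                   ≤⟨ K≤ (ℕ.+-mono-≤ m≤j (ℕ.≤-trans c≤1+m (s≤s m≤j))) ⟩
      2 * (2 + (j + suc j))         ≡⟨ arith j ⟩
      6 + 4 * j                       ≤⟨ ℕ.n≤1+n _ ⟩
      7 + 4 * j                       ≡⟨ posAsc≡ j ⟨
      posAsc j                            ∎)
      where
      open ℕ.≤-Reasoning
      arith : ∀ j → 2 * (2 + (j + suc j)) ≡ 6 + 4 * j
      arith = ℕ-Ring.solve-∀
    pos<K⇒valid (low (suc j)) lt = ℕ.≰⇒> λ c≤1+j → ℕ.<⇒≱ lt (begin
      K                                   ≤⟨ K≤ (ℕ.+-mono-≤ (ℕ.≤-trans m≤c c≤1+j) c≤1+j) ⟩
      2 * (2 + (suc j + suc j))     ≡⟨ arith j ⟩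
      8 + 4 * j                       ≡⟨ cong suc (posAsc≡ j) ⟨
      suc (posAsc j)                      ∎)
      where
      open ℕ.≤-Reasoning
      arith : ∀ j → 2 * (2 + (suc j + suc j)) ≡ 8 + 4 * j
      arith = ℕ-Ring.solve-∀
    pos<K⇒valid (des (suc j)) lt = pos<K⇒valid (low (suc j)) (ℕ.<-trans (ℕ.n<1+n _) lt)
    pos<K⇒valid (upp (suc (suc j))) lt = ℕ.≰⇒> λ m≤1+j → ℕ.<⇒≱ lt (begin
      K                                   ≤⟨ K≤ (ℕ.+-mono-≤ m≤1+j (ℕ.≤-trans c≤1+m (s≤s m≤1+j))) ⟩
      2 * (2 + (suc j + suc (suc j))) ≡⟨ arith j ⟩
      10 + 4 * j                      ≡⟨ cong (3 +_) (posAsc≡ j) ⟨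
      3 + posAsc j                      ∎)
      where
      open ℕ.≤-Reasoning
      arith : ∀ j → 2 * (2 + (suc j + suc (suc j))) ≡ 10 + 4 * j
      arith = ℕ-Ring.solve-∀

    valid⇒pos<K : ∀ d → Valid d → pos d < K
    valid⇒pos<K ascA _ = ℕ.≤-trans (s≤s z≤n) K≥8
    valid⇒pos<K (low zero) _ = ℕ.≤-trans (s≤s (s≤s z≤n)) K≥8
    valid⇒pos<K (des zero) _ = ℕ.≤-trans (ℕ.m≤m+n 3 5) K≥8
    valid⇒pos<K (upp zero) _ = ℕ.≤-trans (ℕ.m≤m+n 4 4) K≥8
    valid⇒pos<K ascB _ = ℕ.≤-trans (ℕ.m≤m+n 5 3) K≥8
    valid⇒pos<K desB _ = ℕ.≤-trans (ℕ.m≤m+n 6 2) K≥8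
    valid⇒pos<K (upp (suc zero)) _ = ℕ.≤-trans (ℕ.m≤m+n 7 1) K≥8
    valid⇒pos<K (asc j) j<m = begin
      suc (posAsc j)                      ≡⟨ cong suc (posAsc≡ j) ⟩
      8 + 4 * j                       ≡⟨ arith j ⟩
      2 * (2 + (suc j + suc j))     ≤⟨ K≥ (ℕ.+-mono-≤ j<m (ℕ.≤-trans j<m m≤c)) ⟩
      K                                   ∎
      where
      open ℕ.≤-Reasoning
      arith : ∀ j → 8 + 4 * j ≡ 2 * (2 + (suc j + suc j))
      arith = ℕ-Ring.solve-∀
    valid⇒pos<K (low (suc j)) 1+j<c = ℕ.<-trans (ℕ.n<1+n _) (valid⇒pos<K (des (suc j)) 1+j<c)
    valid⇒pos<K (des (suc j)) 1+j<c = begin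
      3 + posAsc j                      ≡⟨ cong (3 +_) (posAsc≡ j) ⟩
      10 + 4 * j                      ≡⟨ arith j ⟩
      2 * (2 + (suc j + suc (suc j))) ≤⟨ K≥ (ℕ.+-mono-≤ (ℕ.s≤s⁻¹ (ℕ.≤-trans 1+j<c c≤1+m)) 1+j<c) ⟩
      K                                   ∎
      where
      open ℕ.≤-Reasoning
      arith : ∀ j → 10 + 4 * j ≡ 2 * (2 + (suc j + suc (suc j)))
      arith = ℕ-Ring.solve-∀
    valid⇒pos<K (upp (suc (suc j))) 2+j≤m = begin
      4 + posAsc j                      ≡⟨ cong (4 +_) (posAsc≡ j) ⟩
      11 + 4 * j                      ≤⟨ ℕ.n≤1+n _ ⟩
      12 + 4 * j                      ≡⟨ arith j ⟩
      2 * (2 + (suc (suc j) + suc (suc j))) ≤⟨ K≥ (ℕ.+-mono-≤ 2+j≤m (ℕ.≤-trans 2+j≤m m≤c)) ⟩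
      K                                   ∎
      where
      open ℕ.≤-Reasoning
      arith : ∀ j → 12 + 4 * j ≡ 2 * (2 + (suc (suc j) + suc (suc j)))
      arith = ℕ-Ring.solve-∀

    -- The falling line des j meets row c in column 3 + j + m and row c + 1 in column η j.
    -- des m, present only for e = 1, is steeper so that it returns to the starting vertex.
    η κ : ℕ → ℕ
    η j with j ℕ.≟ m
    ... | yes _ = 2 + m
    ... | no _  = suc j
    κ j with j ℕ.≟ m
    ... | yes _ = suc m
    ... | no _  = 2 + m

    η-m : η m ≡ 2 + m
    η-m with m ℕ.≟ m
    ... | yes _  = refl
    ... | no m≢m = contradiction refl m≢m

    η-≢ : ∀ {j} → j ≢ m → η j ≡ suc j
    η-≢ {j} j≢m with j ℕ.≟ m
    ... | yes j≡m = contradiction j≡m j≢m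
    ... | no _ = refl

    κ-≢ : ∀ {j} → j ≢ m → κ j ≡ 2 + m
    κ-≢ {j} j≢m with j ℕ.≟ m
    ... | yes j≡m = contradiction j≡m j≢m
    ... | no _ = refl

    κ-m : κ m ≡ suc m
    κ-m with m ℕ.≟ m
    ... | yes _  = refl
    ... | no m≢m = contradiction refl m≢m

    η+κ : ∀ j → 3 + (j + m) ≡ η j + κ j
    η+κ j with j ℕ.≟ m
    ... | yes refl = cong (2 +_) (sym (ℕ.+-suc m m))
    ... | no _ = cong suc (sym (trans (ℕ.+-suc j (suc m)) (cong suc (ℕ.+-suc j m))))

    1+m≤κ : ∀ j → suc m ≤ κ j
    1+m≤κ j with j ℕ.≟ m
    ... | yes _ = ℕ.≤-refl
    ... | no _  = ℕ.n≤1+n _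

    -- The grid points intended for each edge, described in ℕ alone; `sound` and `complete` later
    -- identify them with the grid points on the segment.
    Owns : Label → ℕ → ℕ → Set
    Owns ascA    = Hit c 0 (suc m)
    Owns ascB    = Hit c (2 + m) (2 + m + c)
    Owns (asc j) = Hit c (suc j) (suc j + suc c)
    Owns desB    = Hit c (suc m) 0
    Owns (des j) = Hit c (3 + (j + m)) (η j)
    Owns (low j) a b = b + suc j ≡ c
    Owns (upp j) a b = b ≡ c + (2 + j)

    -- Row c reads from left to right: `ascA`, the `asc j`, `desB`, `ascB`, the `des j`. Row c + 1
    -- reads: `desB`, the `des j` with `j < m`, `ascA`, a block of width `e` for `des m`, the
    -- `asc j`, `ascB`.
    owner₀ owner₁ : ℕ → Label
    owner₀ zero = ascA
    owner₀ (suc a) with split m a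
    ... | inj₁ j             = asc j
    ... | inj₂ 0             = desB
    ... | inj₂ 1             = ascB
    ... | inj₂ (suc (suc j)) = des j
    owner₁ zero = desB
    owner₁ (suc a) with split m a
    ... | inj₁ j       = des j
    ... | inj₂ 0       = ascA
    ... | inj₂ (suc r) with split e r
    ...   | inj₁ _  = des m
    ...   | inj₂ r′ with split m r′
    ...     | inj₁ j = asc j
    -- Within the grid this is the last column only; beyond it `ascB` is a default.
    ...     | inj₂ _ = ascB

    owner : ℕ → ℕ → Label
    owner a b with split c b
    ... | inj₁ b             = low (c ∸ suc b)
    ... | inj₂ 0             = owner₀ a
    ... | inj₂ 1             = owner₁ a
    ... | inj₂ (suc (suc j)) = upp j

    owner-c : ∀ a → owner a c ≡ owner₀ a
    owner-c a rewrite split-+ c 0 = refl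

    owner-1+c : ∀ a → owner a (suc c) ≡ owner₁ a
    owner-1+c a rewrite split-+ c 1 = refl

    owner-hit : ∀ {x y a b} d → owner₀ x ≡ d → owner₁ y ≡ d → Hit c x y a b → owner a b ≡ d
    owner-hit d eq₀ eq₁ (inj₁ (refl , refl)) = trans (owner-c _) eq₀
    owner-hit d eq₀ eq₁ (inj₂ (refl , refl)) = trans (owner-1+c _) eq₁

    owner₀-asc : ∀ {j} → j < m → owner₀ (suc j) ≡ asc j
    owner₀-asc j<m rewrite split-< j<m = refl

    owner₀-des : ∀ j → owner₀ (3 + (j + m)) ≡ des j
    owner₀-des j rewrite split-+ m (2 + j) = refl

    owner₁-des : ∀ {j} → j < c → owner₁ (η j) ≡ des j
    owner₁-des {j} j<c with ℕ.m≤n⇒m<n∨m≡n (ℕ.s≤s⁻¹ (ℕ.≤-trans j<c c≤1+m))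
    ... | inj₁ j<m rewrite η-≢ (ℕ.<⇒≢ j<m) | split-< j<m = refl
    -- Here `m < e + m` forces `0 < e`, so column `2 + m` lies in the block of width `e`.
    ... | inj₂ refl rewrite η-m | split-+ m 1 | split-< (ℕ.+-cancelʳ-< m 0 e j<c) = refl

    asc-col : ∀ j → 2 + (j + e + m) ≡ suc j + suc c
    asc-col j = reshape j e m
      where
      reshape : ∀ j e m → 2 + (j + e + m) ≡ suc j + suc (e + m)
      reshape = ℕ-Ring.solve-∀

    ascB-col : 2 + (m + e + m) ≡ 2 + m + c
    ascB-col = cong (2 +_) (ℕ.+-assoc m e m)

    owner₁-asc : ∀ {j} → j < m → owner₁ (suc j + suc c) ≡ asc j
    owner₁-asc {j} j<m = trans (cong owner₁ (sym (asc-col j))) far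
      where
      far : owner₁ (2 + (j + e + m)) ≡ asc j
      far rewrite split-+ m (suc (j + e)) | split-+ e j | split-< j<m = refl

    owner₁-ascB : owner₁ (2 + m + c) ≡ ascB
    owner₁-ascB = trans (cong owner₁ (sym ascB-col)) far
      where
      far : owner₁ (2 + (m + e + m)) ≡ ascB
      far rewrite split-+ m (suc (m + e)) | split-+ e m | split-+ m 0 = refl

    -- Since `owner` is a function of the grid point, two edges through the same point must have the
    -- same label; no edges are compared pairwise.
    owner-unique : ∀ d {a b} → Valid d → Owns d a b → owner a b ≡ d
    owner-unique ascA _ = owner-hit ascA refl eq₁
      where
      eq₁ : owner₁ (suc m) ≡ ascA
      eq₁ rewrite split-+ m 0 = refl
    owner-unique ascB _ = owner-hit ascB eq₀ owner₁-ascB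
      where
      eq₀ : owner₀ (2 + m) ≡ ascB
      eq₀ rewrite split-+ m 1 = refl
    owner-unique desB _ = owner-hit desB eq₀ refl
      where
      eq₀ : owner₀ (suc m) ≡ desB
      eq₀ rewrite split-+ m 0 = refl
    owner-unique (asc j) j<m = owner-hit (asc j) (owner₀-asc j<m) (owner₁-asc j<m)
    owner-unique (des j) j<c = owner-hit (des j) (owner₀-des j) (owner₁-des j<c)
    owner-unique (low j) {a} {b} _ eq rewrite split-< {c} {b} (subst (suc b ≤_) (trans (sym (ℕ.+-suc b j)) eq) (ℕ.m≤m+n (suc b) j)) =
      cong low (trans (cong (_∸ suc b) (trans (sym eq) (ℕ.+-suc b j))) (ℕ.m+n∸m≡n (suc b) j))
    owner-unique (upp j) {a} {b} _ refl rewrite ℕ.+-comm c (2 + j) | split-+ c (2 + j) = refl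

    owned₀ : ∀ a → a < n → ∃ λ d → Valid d × Owns d a c
    owned₀ zero _ = ascA , tt , inj₁ (refl , refl)
    owned₀ (suc a) (s≤s a<) with <⊎+ m a
    ... | inj₁ a<m                          = asc a , a<m , inj₁ (refl , refl)
    ... | inj₂ (0 , refl)                   = desB , tt , inj₁ (refl , refl)
    ... | inj₂ (1 , refl)                   = ascB , tt , inj₁ (refl , refl)
    ... | inj₂ (suc (suc j) , refl)         = des j ,
      ℕ.+-cancelʳ-< m j c (subst (j + m <_) (ℕ.+-comm m c) (ℕ.s≤s⁻¹ (ℕ.s≤s⁻¹ a<))) , inj₁ (refl , refl)

    owned₁ : ∀ a → a < n → ∃ λ d → Valid d × Owns d a (suc c)
    owned₁ zero _ = desB , tt , inj₂ (refl , refl)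
    owned₁ (suc a) (s≤s a<) with <⊎+ m a
    ... | inj₁ a<m = des a , ℕ.<-≤-trans a<m m≤c , inj₂ (refl , sym (η-≢ (ℕ.<⇒≢ a<m)))
    ... | inj₂ (0 , refl) = ascA , tt , inj₂ (refl , refl)
    ... | inj₂ (suc r , refl) = beyond r (ℕ.s≤s⁻¹ (ℕ.s≤s⁻¹ a<))
      where
      overflow : ∀ s e m → m + (e + m) + s ≡ s + m + e + m
      overflow = ℕ-Ring.solve-∀
      beyond : ∀ r → r + m ≤ m + c → ∃ λ d → Valid d × Owns d (2 + (r + m)) (suc c)
      beyond r r≤ with <⊎+ e r
      ... | inj₁ r<e = des m , ℕ.+-monoˡ-≤ m (ℕ.≤-trans (s≤s z≤n) r<e) ,
              inj₂ (refl , trans (cong (λ r → 2 + (r + m)) (ℕ.n<1⇒n≡0 (ℕ.<-≤-trans r<e e≤1))) (sym η-m))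
      ... | inj₂ (r′ , refl) with <⊎+ m r′
      ...   | inj₁ r′<m = asc r′ , r′<m , inj₂ (refl , asc-col r′)
      ...   | inj₂ (zero , refl) = ascB , tt , inj₂ (refl , ascB-col)
      ...   | inj₂ (suc s , refl) = contradiction r≤
        (ℕ.<⇒≱ (s≤s (ℕ.≤-trans (ℕ.m≤m+n (m + (e + m)) s) (ℕ.≤-reflexive (overflow s e m)))))

    owned : ∀ a b → a < n → b < n → ∃ λ d → Valid d × Owns d a b
    owned a b a<n b<n with <⊎+ c b
    ... | inj₁ b<c = low (c ∸ suc b) , ℕ.∸-monoʳ-< (s≤s z≤n) b<c ,
            trans (ℕ.+-suc b _) (ℕ.m+[n∸m]≡n b<c)
    ... | inj₂ (0 , refl) = owned₀ a a<n
    ... | inj₂ (1 , refl) = owned₁ a a<n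
    ... | inj₂ (suc (suc j) , refl) = upp j , ℕ.+-cancelʳ-≤ c j m (ℕ.s≤s⁻¹ (ℕ.s≤s⁻¹ (ℕ.s≤s⁻¹ b<n))) , ℕ.+-comm (2 + j) c

    1+m<n : suc m < n
    1+m<n = s≤s (s≤s (ℕ.≤-trans (ℕ.m≤m+n m c) (ℕ.n≤1+n _)))

    2+c≤n : 2 + c ≤ n
    2+c≤n = ℕ.≤-trans (ℕ.+-monoʳ-≤ 2 (ℕ.m≤n+m c m)) (ℕ.n≤1+n _)

    c<n : c < n
    c<n = ℕ.≤-trans (ℕ.n≤1+n _) 2+c≤n

    owns-inhabited : ∀ d → Valid d → ∃ λ a → ∃ λ b → a < n × b < n × Owns d a b
    owns-inhabited ascA _ = 0 , c , s≤s z≤n , c<n , inj₁ (refl , refl)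
    owns-inhabited ascB _ = 2 + m , c , s≤s (s≤s (s≤s (ℕ.m≤m+n m c))) , c<n , inj₁ (refl , refl)
    owns-inhabited desB _ = 0 , suc c , s≤s z≤n , 2+c≤n , inj₂ (refl , refl)
    owns-inhabited (asc j) j<m = suc j , c , ℕ.<-trans (s≤s j<m) 1+m<n , c<n , inj₁ (refl , refl)
    owns-inhabited (des j) j<c = 3 + (j + m) , c ,
      s≤s (s≤s (s≤s (subst (suc (j + m) ≤_) (ℕ.+-comm c m) (ℕ.+-monoˡ-≤ m j<c)))) , c<n , inj₁ (refl , refl)
    owns-inhabited (low j) j<c = 0 , c ∸ suc j , s≤s z≤n , ℕ.≤-<-trans (ℕ.m∸n≤m c (suc j)) c<n , ℕ.m∸n+n≡m j<c
    owns-inhabited (upp j) j≤m = 0 , c + (2 + j) , s≤s z≤n ,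
      subst (_≤ n) (ℕ.+-comm (3 + j) c ∙ ℕ.+-suc c (2 + j)) (ℕ.+-monoˡ-≤ c (s≤s (s≤s (s≤s j≤m)))) , refl
      where _∙_ = trans

open EdgeLabels

-- Coordinates of the vertices and verification of the tour.

module Zigzags where

  open import Data.Integer using (+_; +[1+_])
  open import Data.Rational using (_+_; _*_; _-_; _≤_; _<_)

  1/1+ : ℕ → ℚ
  1/1+ k = mkℚ (+ 1) k (1-coprimeTo (suc k))

  ι-1/1+ : ∀ k → ι (suc k) * 1/1+ k ≡ 1ℚ
  ι-1/1+ k rewrite ι-mkℚ (suc k) = ℚ.*-inverseʳ (mkℚ +[1+ k ] 0 (Coprime.sym (1-coprimeTo (suc k))))

  0<1/1+ : ∀ k → 0ℚ < 1/1+ k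
  0<1/1+ k = ℚ.positive⁻¹ (1/1+ k)

  1/1+<1 : ∀ k → 1/1+ (suc k) < 1ℚ
  1/1+<1 k = *<* (subst (+ 1 ℤ.<_) (sym (ℤ.*-identityˡ +[1+ suc k ])) (ℤ.+<+ (s≤s (s≤s z≤n))))

  -ι≤0 : ∀ a → - ι a ≤ 0ℚ
  -ι≤0 a = ℚ.neg-antimono-≤ (0≤ι a)

  module Zigzag (m′ e : ℕ) (e≤1 : e ℕ.≤ 1) where
    open Labels m′ e e≤1

    -- Solutions of two linear equations for `s`. The lines `B` and `D` meet where
    -- `2 + m + c * s = (m + 1) - (m + 1) * s`, at `s = - t`; the lines `A` and `G m` meet where
    -- `(m + 1) * s = (2 * m + 3) - (m + 1) * s`, at `s = 1 + r`.
    r t : ℚ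
    r = 1/1+ (suc (m ℕ.+ m))
    t = 1/1+ (m ℕ.+ c)

    A B D : ℚ → Point
    A = rise 0 (suc m) c
    B = rise (2 ℕ.+ m) c c
    D = fall (suc m) (suc m) c

    F G : ℕ → ℚ → Point
    F j = rise (suc j) (suc c) c
    G j = fall (3 ℕ.+ (j ℕ.+ m)) (κ j) c

    -- The height at which `des j` ends. It goes from 2 to 4 between `des 0` and a regular `des 1`
    -- because row `c + 3` is entered from `desB`; `des m` ends at the closing vertex instead.
    τ : ℕ → ℚ
    τ zero    = ι 2
    τ (suc j) with suc j ℕ.≟ m
    ... | yes _ = ι 1 + r
    ... | no _  = ι (4 ℕ.+ j)

    τ-m : τ m ≡ ι 1 + r
    τ-m with m ℕ.≟ m
    ... | yes _  = refl
    ... | no m≢m = contradiction refl m≢m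

    τ-suc : ∀ {j} → suc j ≢ m → τ (suc j) ≡ ι (4 ℕ.+ j)
    τ-suc {j} ≢m with suc j ℕ.≟ m
    ... | yes ≡m = contradiction ≡m ≢m
    ... | no _   = refl

    -- Only the initial vertex of an edge is given; the final one is that of the next label, which
    -- makes the chain connected by construction.
    begins : Label → Point
    begins ascA                = A (ι 1 + r)
    begins ascB                = B (ι 2)
    begins (asc j)             = F j (ι (3 ℕ.+ j))
    begins desB                = D (- t)
    begins (des j)             = G j (- ι (suc j))
    begins (low zero)          = A (- ι 1)
    begins (low (suc j))       = F j (- ι (2 ℕ.+ j))
    begins (upp zero)          = G 0 (τ 0)
    begins (upp (suc zero))    = D (ι 3)
    begins (upp (suc (suc j))) = G (suc j) (τ (suc j))

    ends : Label → Point
    ends d = begins (next d)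

    -- A summand 1 is expanded to `(ι (suc m) + ι c) * t`, after which the claim is a ring identity.
    -- `G≡A` uses `r` in the same way.
    B≡D : B (- t) ≡ D (- t)
    B≡D = cong (_, ι c + - t) (begin
      ι (2 ℕ.+ m) + ι c * - t
        ≡⟨ cong (_+ ι c * - t) (ι-+ 1 (suc m)) ⟩
      1ℚ + ι (suc m) + ι c * - t
        ≡⟨ cong (λ z → z + ι (suc m) + ι c * - t) (trans (cong (_* t) (sym (ι-+ (suc m) c))) (ι-1/1+ (m ℕ.+ c))) ⟨
      (ι (suc m) + ι c) * t + ι (suc m) + ι c * - t
        ≡⟨ solve 3 (λ a b t → (a :+ b) :* t :+ a :+ b :* (:- t) := a :+ (:- a) :* (:- t)) refl (ι (suc m)) (ι c) t ⟩
      ι (suc m) + - ι (suc m) * - t ∎)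
      where open ≡-Reasoning

    G≡A : G m (τ m) ≡ A (ι 1 + r)
    G≡A = trans (cong₂ (λ k s → fall (3 ℕ.+ (m ℕ.+ m)) k c s) κ-m τ-m) (cong (_, ι c + (ι 1 + r)) (begin
      ι (3 ℕ.+ (m ℕ.+ m)) + - ι (suc m) * (1ℚ + r)
        ≡⟨ cong (_+ - ι (suc m) * (1ℚ + r)) (trans (ι-+ 1 (2 ℕ.+ (m ℕ.+ m)))
             (cong₂ _+_ (sym (ι-1/1+ (suc (m ℕ.+ m)))) refl)) ⟩
      ι (2 ℕ.+ (m ℕ.+ m)) * r + ι (2 ℕ.+ (m ℕ.+ m)) + - ι (suc m) * (1ℚ + r)
        ≡⟨ cong (λ z → z * r + z + - ι (suc m) * (1ℚ + r))
             (trans (cong (λ z → ι (suc z)) (sym (ℕ.+-suc m m))) (ι-+ (suc m) (suc m))) ⟩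
      (ι (suc m) + ι (suc m)) * r + (ι (suc m) + ι (suc m)) + - ι (suc m) * (1ℚ + r)
        ≡⟨ solve 2 (λ a r → (a :+ a) :* r :+ (a :+ a) :+ (:- a) :* (con 1ℚ :+ r)
                          := con 0ℚ :+ a :* (con 1ℚ :+ r)) refl (ι (suc m)) r ⟩
      0ℚ + ι (suc m) * (1ℚ + r) ∎))
      where open ≡-Reasoning

    -t≤0 : - t ≤ 0ℚ
    -t≤0 = ℚ.neg-antimono-≤ (ℚ.<⇒≤ (0<1/1+ (m ℕ.+ c)))

    -1<-t : - ι 1 < - t
    -1<-t = ℚ.neg-antimono-< (1/1+<1 (m′ ℕ.+ c))

    1<1+r : ι 1 < ι 1 + r
    1<1+r = ℚ.+-monoʳ-< (ι 1) (0<1/1+ (suc (m ℕ.+ m)))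

    1+r<2 : ι 1 + r < ι 2
    1+r<2 = ℚ.+-monoʳ-< (ι 1) (1/1+<1 (m ℕ.+ m))

    1≤ι : ∀ s → ι 1 ≤ ι (suc s)
    1≤ι s = ι-mono-≤ {1} {suc s} (s≤s z≤n)

    1≤τ : ∀ j → ι 1 ≤ τ j
    1≤τ zero = 1≤ι 1
    1≤τ (suc j) with suc j ℕ.≟ m
    ... | yes _ = ℚ.<⇒≤ 1<1+r
    ... | no _  = 1≤ι (3 ℕ.+ j)

    -- An edge that reaches both rows `c` and `c + 1` is not horizontal, which is all that a turn
    -- against a row requires.
    steep : ∀ {lo hi} → lo ≤ 0ℚ → ι 1 ≤ hi → ι c + lo ≢ ι c + hi
    steep lo≤0 1≤hi = ℚ.<⇒≢ (ℚ.+-monoʳ-< (ι c) (lo<hi lo≤0 1≤hi))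

    n≤4+2m : n ℕ.≤ 4 ℕ.+ (m ℕ.+ m)
    n≤4+2m = subst (n ℕ.≤_) (cong (3 ℕ.+_) (ℕ.+-suc m m)) (ℕ.+-monoʳ-≤ 3 (ℕ.+-monoʳ-≤ m c≤1+m))

    -- The least value, at `j = 0` with the smaller step `m + 1`, is `4 + 2 * m`, still at least
    -- `n`.
    n≤des+κ : ∀ j → n ℕ.≤ 3 ℕ.+ (j ℕ.+ m) ℕ.+ κ j
    n≤des+κ j = begin
      n                                ≤⟨ n≤4+2m ⟩
      4 ℕ.+ (m ℕ.+ m)                  ≡⟨ cong (3 ℕ.+_) (ℕ.+-suc m m) ⟨
      3 ℕ.+ m ℕ.+ suc m                ≤⟨ ℕ.+-mono-≤ (ℕ.+-monoʳ-≤ 3 (ℕ.m≤n+m m j)) (1+m≤κ j) ⟩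
      3 ℕ.+ (j ℕ.+ m) ℕ.+ κ j          ∎
      where open ℕ.≤-Reasoning

    n≤ascB : n ℕ.≤ 2 ℕ.+ m ℕ.+ c ℕ.* 2
    n≤ascB = begin
      3 ℕ.+ (m ℕ.+ c)                  ≡⟨ cong (2 ℕ.+_) (ℕ.+-suc m c) ⟨
      2 ℕ.+ m ℕ.+ suc c                ≤⟨ ℕ.+-monoʳ-≤ (2 ℕ.+ m) (ℕ.+-monoˡ-≤ c (ℕ.≤-trans (s≤s z≤n) m≤c)) ⟩
      2 ℕ.+ m ℕ.+ (c ℕ.+ c)            ≡⟨ cong (2 ℕ.+ m ℕ.+_) (trans (cong (c ℕ.+_) (sym (ℕ.+-identityʳ c))) (ℕ.*-comm 2 c)) ⟩
      2 ℕ.+ m ℕ.+ c ℕ.* 2              ∎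
      where open ℕ.≤-Reasoning

    n≤asc : ∀ j s → n ℕ.≤ suc j ℕ.+ suc c ℕ.* (2 ℕ.+ s)
    n≤asc j s = begin
      3 ℕ.+ (m ℕ.+ c)                  ≤⟨ ℕ.+-monoʳ-≤ 3 (ℕ.+-monoˡ-≤ c m≤c) ⟩
      3 ℕ.+ (c ℕ.+ c)                  ≡⟨ arith c ⟩
      1 ℕ.+ suc c ℕ.* 2                ≤⟨ ℕ.+-mono-≤ (s≤s (z≤n {j})) (ℕ.*-monoʳ-≤ (suc c) (ℕ.m≤m+n 2 s)) ⟩
      suc j ℕ.+ suc c ℕ.* (2 ℕ.+ s)    ∎
      where
      open ℕ.≤-Reasoning
      arith : ∀ c → 3 ℕ.+ (c ℕ.+ c) ≡ 1 ℕ.+ suc c ℕ.* 2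
      arith = ℕ-Ring.solve-∀

    -- The restriction is essential: `des m` prolonged to row `c + 2` would hit column 1.
    des<2κ : ∀ {j} → j ℕ.< m → 3 ℕ.+ (j ℕ.+ m) ℕ.< κ j ℕ.* 2
    des<2κ {j} j<m rewrite κ-≢ (ℕ.<⇒≢ j<m) = begin
      3 ℕ.+ (suc j ℕ.+ m)              ≤⟨ ℕ.+-monoʳ-≤ 3 (ℕ.+-monoˡ-≤ m j<m) ⟩
      3 ℕ.+ (m ℕ.+ m)                  ≤⟨ ℕ.n≤1+n _ ⟩
      4 ℕ.+ (m ℕ.+ m)                  ≡⟨ arith m ⟩
      (2 ℕ.+ m) ℕ.* 2                  ∎
      where
      open ℕ.≤-Reasoning
      arith : ∀ m → 4 ℕ.+ (m ℕ.+ m) ≡ (2 ℕ.+ m) ℕ.* 2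
      arith = ℕ-Ring.solve-∀

    Level : Point → Point → Set
    Level p q = proj₁ p ≤ 0ℚ × ι n ≤ proj₁ q × proj₂ p ≡ proj₂ q

    level-< : ∀ {p q} → Level p q → proj₁ p < proj₁ q
    level-< (p≤0 , n≤q , _) = ℚ.≤-<-trans p≤0 (ℚ.<-≤-trans (ι-mono-< {0} {n} (s≤s z≤n)) n≤q)

    level-passes : ∀ p q a b → Level p q → a ℕ.< n → ι b ≡ proj₂ q → OnSeg p q (gridPt a b)
    level-passes p q a b (p≤0 , n≤q , eq) a<n = level-on p q (gridPt a b) eq
      (ℚ.≤-trans p≤0 (0≤ι a)) (ℚ.≤-trans (ι-mono-≤ {a} {n} (ℕ.<⇒≤ a<n)) n≤q)

    level-passes⁻¹ : ∀ p q a b → Level p q → OnSeg p q (gridPt a b) → ι b ≡ proj₂ q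
    level-passes⁻¹ p q a b lvl@(_ , _ , eq) = level-off p q (gridPt a b) (level-< {p} {q} lvl) eq

    level-low : ∀ j → Level (begins (low j)) (begins (des j))
    level-low zero = rise-left 0 (suc m) 1 z≤n , fall-right (3 ℕ.+ m) (κ 0) 1
      (subst (λ k → n ℕ.≤ 3 ℕ.+ m ℕ.+ k) (sym (ℕ.*-identityʳ (κ 0))) (n≤des+κ 0)) , refl
    level-low (suc j) = rise-left (suc j) (suc c) (2 ℕ.+ j) (ℕ.≤-trans (ℕ.n≤1+n _) (ℕ.m≤m+n (2 ℕ.+ j) _)) ,
      fall-right (3 ℕ.+ (suc j ℕ.+ m)) (κ (suc j)) (2 ℕ.+ j)
        (ℕ.≤-trans (n≤des+κ (suc j)) (ℕ.+-monoʳ-≤ (3 ℕ.+ (suc j ℕ.+ m)) (ℕ.m≤m*n (κ (suc j)) (2 ℕ.+ j)))) , refl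

    -- The bound keeps out `upp (suc m)`, which begins at the upper end of `des m`, strictly between
    -- two rows.
    level-upp : ∀ j → j ℕ.≤ m → Level (begins (upp j)) (ends (upp j))
    level-upp zero _ = fall-left (3 ℕ.+ m) (κ 0) 2 (ℕ.<⇒≤ (des<2κ {0} (s≤s z≤n))) ,
      rise-right (2 ℕ.+ m) c 2 n≤ascB , refl
    level-upp (suc zero) _ = fall-left (suc m) (suc m) 3 (ℕ.m≤m*n (suc m) 3) ,
      rise-right 1 (suc c) 3 (n≤asc 0 1) , refl
    level-upp (suc (suc j)) 1+j<m =
      subst (λ s → ι (3 ℕ.+ (suc j ℕ.+ m)) + - ι (κ (suc j)) * s ≤ 0ℚ) (sym τ≡)
        (fall-left (3 ℕ.+ (suc j ℕ.+ m)) (κ (suc j)) (4 ℕ.+ j)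
          (ℕ.≤-trans (ℕ.<⇒≤ (des<2κ 1+j<m)) (ℕ.*-monoʳ-≤ (κ (suc j)) (ℕ.m≤m+n 2 (2 ℕ.+ j))))) ,
      rise-right (2 ℕ.+ j) (suc c) (4 ℕ.+ j) (n≤asc (suc j) (2 ℕ.+ j)) ,
      cong (_+_ (ι c)) τ≡
      where τ≡ = τ-suc (ℕ.<⇒≢ 1+j<m)

    -- Stated with `G` and `τ` because `begins` and `ends` of `des j` agree with them only after a
    -- case split on `j`.
    passes-des : ∀ j a b → j ℕ.< c → a ℕ.< n →
      (OnSeg (G j (- ι (suc j))) (G j (τ j)) (gridPt a b) → Owns (des j) a b)
      × (Owns (des j) a b → OnSeg (G j (- ι (suc j))) (G j (τ j)) (gridPt a b))
    passes-des j a b j<c a<n =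
      fall-off lo≤0 (1≤τ j) x (η j) (κ j) c a b (η+κ j) a<n (steep-or-short (ℕ.m≤n⇒m<n∨m≡n (ℕ.s≤s⁻¹ (ℕ.≤-trans j<c c≤1+m))))
        (inj₂ (n≤des+κ j)) ,
      fall-on lo≤0 (1≤τ j) x (η j) (κ j) c a b (η+κ j)
      where
      x = 3 ℕ.+ (j ℕ.+ m)
      lo≤0 = -ι≤0 (suc j)
      steep-or-short : j ℕ.< m ⊎ j ≡ m → τ j < ι 2 ⊎ x ℕ.< κ j ℕ.* 2
      steep-or-short (inj₁ j<m)  = inj₂ (des<2κ j<m)
      steep-or-short (inj₂ refl) = inj₁ (subst (_< ι 2) (sym τ-m) 1+r<2)

    -- For each end of a slanted edge, `inj₁` certifies that it stops before the next row and `inj₂`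
    -- that its line has left the grid by then. The former is used for the upper ends of `ascA` and
    -- `des m` and the lower ends of `ascB` and `desB`.
    sound : ∀ d a b → Valid d → a ℕ.< n → OnSeg (begins d) (ends d) (gridPt a b) → Owns d a b
    sound ascA a b _ a<n on = rise-off (-ι≤0 1) (ℚ.<⇒≤ 1<1+r) 0 (suc m) c a b a<n (inj₁ 1+r<2) (inj₂ (s≤s z≤n))
      (OnSeg-sym (A (ι 1 + r)) (A (- ι 1)) (gridPt a b) on)
    sound ascB a b _ a<n on = rise-off -t≤0 (1≤ι 1) (2 ℕ.+ m) c c a b a<n (inj₂ n≤ascB) (inj₁ -1<-t)
      (OnSeg-sym (B (ι 2)) (B (- t)) (gridPt a b) (subst (λ q → OnSeg (B (ι 2)) q (gridPt a b)) (sym B≡D) on))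
    sound (asc j) a b j<m a<n on = rise-off (-ι≤0 (2 ℕ.+ j)) (1≤ι (2 ℕ.+ j)) (suc j) (suc c) c a b a<n
      (inj₂ (n≤asc j 0)) (inj₂ (s≤s (ℕ.<-≤-trans j<m m≤c)))
      (OnSeg-sym (F j (ι (3 ℕ.+ j))) (F j (- ι (2 ℕ.+ j))) (gridPt a b) on)
    sound desB a b _ a<n = fall-off -t≤0 (1≤ι 2) (suc m) 0 (suc m) c a b refl a<n
      (inj₂ (ℕ.m<m*n (suc m) 2 (s≤s (s≤s z≤n)))) (inj₁ -1<-t)
    sound (des zero) a b j<c a<n = proj₁ (passes-des 0 a b j<c a<n)
    sound (des (suc j)) a b j<c a<n = proj₁ (passes-des (suc j) a b j<c a<n)
    sound (low j) a b j<c a<n on = row-below b c (suc j)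
      (level-passes⁻¹ (begins (low j)) (begins (des j)) a b (level-low j) on)
    sound (upp zero) a b j≤m a<n on = row-above b c 2
      (level-passes⁻¹ (begins (upp 0)) (ends (upp 0)) a b (level-upp 0 j≤m) on)
    sound (upp (suc zero)) a b j≤m a<n on = row-above b c 3
      (level-passes⁻¹ (begins (upp 1)) (ends (upp 1)) a b (level-upp 1 j≤m) on)
    sound (upp (suc (suc j))) a b j≤m a<n on = row-above b c (4 ℕ.+ j)
      (level-passes⁻¹ (begins (upp (2 ℕ.+ j))) (ends (upp (2 ℕ.+ j))) a b (level-upp (2 ℕ.+ j) j≤m) on)

    complete : ∀ d a b → Valid d → a ℕ.< n → Owns d a b → OnSeg (begins d) (ends d) (gridPt a b)
    complete ascA a b _ a<n own = OnSeg-sym (A (- ι 1)) (A (ι 1 + r)) (gridPt a b)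
      (rise-on (-ι≤0 1) (ℚ.<⇒≤ 1<1+r) 0 (suc m) c a b own)
    complete ascB a b _ a<n own = subst (λ q → OnSeg (B (ι 2)) q (gridPt a b)) B≡D
      (OnSeg-sym (B (- t)) (B (ι 2)) (gridPt a b) (rise-on -t≤0 (1≤ι 1) (2 ℕ.+ m) c c a b own))
    complete (asc j) a b j<m a<n own = OnSeg-sym (F j (- ι (2 ℕ.+ j))) (F j (ι (3 ℕ.+ j))) (gridPt a b)
      (rise-on (-ι≤0 (2 ℕ.+ j)) (1≤ι (2 ℕ.+ j)) (suc j) (suc c) c a b own)
    complete desB a b _ a<n = fall-on -t≤0 (1≤ι 2) (suc m) 0 (suc m) c a b refl
    complete (des zero) a b j<c a<n = proj₂ (passes-des 0 a b j<c a<n)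
    complete (des (suc j)) a b j<c a<n = proj₂ (passes-des (suc j) a b j<c a<n)
    complete (low j) a b j<c a<n own = level-passes (begins (low j)) (begins (des j)) a b (level-low j) a<n
      (row-below⁻¹ b c (suc j) own)
    complete (upp zero) a b j≤m a<n own = level-passes (begins (upp 0)) (ends (upp 0)) a b (level-upp 0 j≤m) a<n
      (trans (cong ι own) (ι-+ c 2))
    complete (upp (suc zero)) a b j≤m a<n own = level-passes (begins (upp 1)) (ends (upp 1)) a b (level-upp 1 j≤m) a<n
      (trans (cong ι own) (ι-+ c 3))
    complete (upp (suc (suc j))) a b j≤m a<n own =
      level-passes (begins (upp (2 ℕ.+ j))) (ends (upp (2 ℕ.+ j))) a b (level-upp (2 ℕ.+ j) j≤m) a<n
        (trans (cong ι own) (ι-+ c (4 ℕ.+ j)))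

    into-level : ∀ p q r → proj₂ p ≢ proj₂ q → Level q r → cross (q -ᵖ p) (r -ᵖ q) ≢ 0ℚ
    into-level p q r p≢q lvl = turn-into-level p q r p≢q (level-< {q} {r} lvl) (proj₂ (proj₂ lvl))

    from-level : ∀ p q r → Level p q → proj₂ q ≢ proj₂ r → cross (q -ᵖ p) (r -ᵖ q) ≢ 0ℚ
    from-level p q r lvl = turn-from-level p q r (level-< {p} {q} lvl) (proj₂ (proj₂ lvl))

    turns : ∀ d → Valid d → Valid (next d) →
            cross (ends d -ᵖ begins d) (ends (next d) -ᵖ ends d) ≢ 0ℚ
    turns ascA _ _ = into-level (begins ascA) (begins (low 0)) (begins (des 0))
      (steep (-ι≤0 1) (ℚ.<⇒≤ 1<1+r) ∘ sym) (level-low 0)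
    turns ascB _ _ = subst (λ q → cross (q -ᵖ B (ι 2)) (D (ι 3) -ᵖ q) ≢ 0ℚ) B≡D λ eq →
      turn-between-slants (ι (2 ℕ.+ m)) (ι c) (ι (suc m)) (- ι (suc m)) (ι c) (ι 2) (- t) (ι 3)
        (ℚ.<⇒≢ (lo<hi -t≤0 (1≤ι 1)) ∘ sym) (ℚ.<⇒≢ (lo<hi -t≤0 (1≤ι 2)))
        -- The inverse slopes differ because `- ι (suc m) < 0 ≤ ι c`.
        (ℚ.<⇒≢ (ℚ.<-≤-trans (ℚ.neg-antimono-< (ι-mono-< {0} {suc m} (s≤s z≤n))) (0≤ι c)) ∘ sym)
        (trans (cong (λ q → cross (B (- t) -ᵖ B (ι 2)) (D (ι 3) -ᵖ q)) (sym B≡D)) eq)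
    turns desB _ _ = into-level (begins desB) (begins (upp 1)) (begins (asc 0))
      (steep -t≤0 (1≤ι 2)) (level-upp 1 (s≤s z≤n))
    turns (asc j) _ _ = into-level (begins (asc j)) (begins (low (suc j))) (begins (des (suc j)))
      (steep (-ι≤0 (2 ℕ.+ j)) (1≤ι (2 ℕ.+ j)) ∘ sym) (level-low (suc j))
    turns (des zero) _ v = into-level (begins (des 0)) (begins (upp 0)) (begins ascB)
      (steep (-ι≤0 1) (1≤τ 0)) (level-upp 0 v)
    turns (des (suc j)) _ v = into-level (begins (des (suc j))) (begins (upp (2 ℕ.+ j))) (begins (asc (suc j)))
      (steep (-ι≤0 (2 ℕ.+ j)) (1≤τ (suc j))) (level-upp (2 ℕ.+ j) v)
    turns (low zero) _ _ = from-level (begins (low 0)) (begins (des 0)) (begins (upp 0)) (level-low 0)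
      (steep (-ι≤0 1) (1≤τ 0))
    turns (low (suc j)) _ _ = from-level (begins (low (suc j))) (begins (des (suc j))) (begins (upp (2 ℕ.+ j)))
      (level-low (suc j)) (steep (-ι≤0 (2 ℕ.+ j)) (1≤τ (suc j)))
    turns (upp zero) v _ = from-level (begins (upp 0)) (begins ascB) (begins desB) (level-upp 0 v)
      (steep -t≤0 (1≤ι 1) ∘ sym)
    turns (upp (suc zero)) v _ = from-level (begins (upp 1)) (begins (asc 0)) (begins (low 1)) (level-upp 1 v)
      (steep (-ι≤0 2) (1≤ι 2) ∘ sym)
    turns (upp (suc (suc j))) v _ = from-level (begins (upp (2 ℕ.+ j))) (begins (asc (suc j))) (begins (low (2 ℕ.+ j)))
      (level-upp (2 ℕ.+ j) v) (steep (-ι≤0 (3 ℕ.+ j)) (1≤ι (3 ℕ.+ j)) ∘ sym)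

    V : ℕ → Point
    V i = begins (labelAt i)

    valid-at : ∀ i → i ℕ.< K → Valid (labelAt i)
    valid-at i i<K = pos<K⇒valid (labelAt i) (subst (ℕ._< K) (sym (pos-labelAt i)) i<K)

    cover : ∀ a b → a ℕ.< n → b ℕ.< n → ∃ λ i → i ℕ.< K × OnSeg (V i) (V (suc i)) (gridPt a b)
    cover a b a<n b<n with owned a b a<n b<n
    ... | d , valid , own = pos d , valid⇒pos<K d valid ,
      subst (λ d → OnSeg (begins d) (ends d) (gridPt a b)) (sym (labelAt-pos d)) (complete d a b valid a<n own)

    unique : ∀ i j a b → i ℕ.< K → j ℕ.< K → a ℕ.< n → b ℕ.< n →
             OnSeg (V i) (V (suc i)) (gridPt a b) → OnSeg (V j) (V (suc j)) (gridPt a b) → i ≡ j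
    unique i j a b i<K j<K a<n b<n on-i on-j = begin
      i                ≡⟨ pos-labelAt i ⟨
      pos (labelAt i)  ≡⟨ cong pos (owner-unique (labelAt i) (valid-at i i<K) (sound (labelAt i) a b (valid-at i i<K) a<n on-i)) ⟨
      pos (owner a b)  ≡⟨ cong pos (owner-unique (labelAt j) (valid-at j j<K) (sound (labelAt j) a b (valid-at j j<K) a<n on-j)) ⟩
      pos (labelAt j)  ≡⟨ pos-labelAt j ⟩
      j                ∎
      where open ≡-Reasoning

    inhabited : ∀ i → i ℕ.< K → ∃ λ a → ∃ λ b → a ℕ.< n × b ℕ.< n × OnSeg (V i) (V (suc i)) (gridPt a b)
    inhabited i i<K with owns-inhabited (labelAt i) (valid-at i i<K)
    ... | a , b , a<n , b<n , own = a , b , a<n , b<n , complete (labelAt i) a b (valid-at i i<K) a<n own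

    turn : ∀ i → suc i ℕ.< K → cross (V (suc i) -ᵖ V i) (V (suc (suc i)) -ᵖ V (suc i)) ≢ 0ℚ
    turn i 1+i<K = turns (labelAt i) (valid-at i (ℕ.<-trans (ℕ.n<1+n i) 1+i<K)) (valid-at (suc i) 1+i<K)

    -- The start lies strictly between rows `c + 1` and `c + 2`.
    start∉grid : ∀ a b → gridPt a b ≢ V 0
    start∉grid a b eq = ℕ.<⇒≱ (below-two b c 1+r<2 (ℚ.≤-reflexive b-c≡)) (ι-cancel-< {suc c} {b} 1+c<b)
      where
      b≡ : ι b ≡ ι c + (ι 1 + r)
      b≡ = cong proj₂ eq
      b-c≡ : ι b - ι c ≡ ι 1 + r
      b-c≡ = trans (cong (_- ι c) b≡) (solve 2 (λ c s → c :+ s :- c := s) refl (ι c) (ι 1 + r))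
      1+c<b : ι (suc c) < ι b
      1+c<b = subst₂ _<_ (trans (ℚ.+-comm (ι c) (ι 1)) (sym (ι-+ 1 c))) (sym b≡) (ℚ.+-monoʳ-< (ι c) 1<1+r)

    -- The final vertex stays a hypothesis because its place depends on the parity.
    tour : (∀ a b → gridPt a b ≢ V K) → GridTour n K V
    tour end∉grid = record
      { cover = cover ; unique = unique ; inhabited = inhabited ; turn = turn
      ; start∉grid = start∉grid ; end∉grid = end∉grid }

  module OddGrid (m′ : ℕ) where
    open Labels m′ 0 z≤n using (n; K; m)
    open Zigzag m′ 0 z≤n

    labelAt-K : labelAt K ≡ low m
    labelAt-K = trans (cong labelAt (trans (arith m′) (cong suc (sym (posAsc≡ m′))))) (labelAt-pos (low m))
      where
      arith : ∀ k → 2 ℕ.* (2 ℕ.+ (suc k ℕ.+ suc k)) ≡ 8 ℕ.+ 4 ℕ.* k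
      arith = ℕ-Ring.solve-∀

    -- The last edge runs down to row −1.
    end∉grid : ∀ a b → gridPt a b ≢ V K
    end∉grid a b eq = ℕ.m+1+n≢n b (row-below b m (suc m) (cong proj₂ (trans eq (cong begins labelAt-K))))

    open GridTour (tour end∉grid) public using (chain; coveringPath)

  module EvenGrid (m′ : ℕ) where
    open Labels m′ 1 (s≤s z≤n) using (n; K; m)
    open Zigzag m′ 1 (s≤s z≤n)

    -- Index `K` is one past the last edge `des m`, so the beginning of this label is the end of
    -- `des m`, which `G≡A` identifies with the start.
    labelAt-K : labelAt K ≡ upp (suc m)
    labelAt-K = trans (cong labelAt (trans (arith m′) (cong (3 ℕ.+_) (sym (posAsc≡ m′))))) (labelAt-pos (upp (suc m)))
      where
      arith : ∀ k → 2 ℕ.* (2 ℕ.+ (suc k ℕ.+ suc (suc k))) ≡ 10 ℕ.+ 4 ℕ.* k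
      arith = ℕ-Ring.solve-∀

    closed : V 0 ≡ V K
    closed = sym (trans (cong begins labelAt-K) G≡A)

    open GridTour (tour λ a b eq → start∉grid a b (trans eq (sym closed))) public using (chain; coveringPath; coveringCycle)

    cycle : IsCoveringCycle chain n
    cycle = coveringCycle closed

open Zigzags

-- Decision procedures and explicit chains for the grids with n ≤ 4.

module SmallGrids where

  open import Data.Nat using (_<_)
  open import Data.Integer using (+_)

  _≟ᵖ_ : DecidableEquality Point
  _≟ᵖ_ = Product.≡-dec ℚ._≟_ ℚ._≟_

  onSeg? : ∀ p q x → Dec (OnSeg p q x)
  onSeg? p q x = (_ ℚ.≟ _) ×-dec (_ ℚ.≤? _)

  all<? : ∀ {P : ℕ → ℕ → Set} n → (∀ a b → Dec (P a b)) → Dec (∀ a b → a < n → b < n → P a b)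
  all<? {P} n P? = map′
    (λ h a b a<n b<n → subst₂ P (Fin.toℕ-fromℕ< a<n) (Fin.toℕ-fromℕ< b<n) (h (fromℕ< a<n) (fromℕ< b<n)))
    (λ h i j → h (toℕ i) (toℕ j) (Fin.toℕ<n i) (Fin.toℕ<n j))
    (Fin.all? λ i → Fin.all? λ j → P? (toℕ i) (toℕ j))

  module _ {k : ℕ} (v : Chain k) where

    passesOnEdge? : ∀ x i → Dec (PassesOnEdge v x i)
    passesOnEdge? x i = onSeg? _ _ x ×-dec ¬? (x ≟ᵖ tgt v i)

    isTrail? : Dec (IsTrail v)
    isTrail? = Fin.all? (λ i → ¬? (_ ≟ᵖ _))
      ×-dec Fin.all? (λ i → Fin.all? λ j →
        (((_ ≟ᵖ _) ×-dec (_ ≟ᵖ _)) ⊎-dec ((_ ≟ᵖ _) ×-dec (_ ≟ᵖ _))) →-dec (i Fin.≟ j))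
      ×-dec Fin.all? (λ i → Fin.all? λ j → (_ ℕ.≟ _) →-dec ¬? (_ ℚ.≟ _))

    isCoveringTrail? : ∀ n → Dec (IsCoveringTrail v n)
    isCoveringTrail? n = isTrail? ×-dec all<? n λ a b → Fin.any? (passesOnEdge? _) ⊎-dec (_ ≟ᵖ _)

    isCoveringPath? : ∀ n → Dec (IsCoveringPath v n)
    isCoveringPath? n = isCoveringTrail? n ×-dec all<? n λ a b →
      (Fin.all? λ i → Fin.all? λ j → passesOnEdge? _ i →-dec (passesOnEdge? _ j →-dec (i Fin.≟ j)))
      ×-dec (Fin.all? λ i → passesOnEdge? _ i →-dec ¬? (_ ≟ᵖ _))

    isCoveringCycle? : ∀ n → Dec (IsCoveringCycle v n)
    isCoveringCycle? n = (isCoveringTrail? n ×-dec (_ ≟ᵖ _)) ×-dec all<? n λ a b →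
      Fin.all? λ i → Fin.all? λ j → passesOnEdge? _ i →-dec (passesOnEdge? _ j →-dec (i Fin.≟ j))


  segment : Chain 1
  segment = lookup (gridPt 0 0 ∷ gridPt 1 0 ∷ [])

  triangle : Chain 3
  triangle = lookup ((- 1ℚ , 0ℚ) ∷ gridPt 2 0 ∷ (+ 1 / 2 , + 3 / 2) ∷ (- 1ℚ , 0ℚ) ∷ [])

  -- The classical nine dots solution; starting at (1, 0) leaves the corner (0, 0) to the later
  -- edges.
  nineDots : Chain 4
  nineDots = lookup (gridPt 1 0 ∷ gridPt 3 0 ∷ gridPt 0 3 ∷ gridPt 0 0 ∷ gridPt 2 2 ∷ [])

  -- Both diagonals, with four grid points each, and four lines of slope 1/2 or -1/2, with two each.
  hexagram : Chain 6
  hexagram = lookup (gridPt 4 4 ∷ (- 1ℚ , - 1ℚ) ∷ (ℕtoℚ 4 , + 3 / 2) ∷ (- 1ℚ , ℕtoℚ 4)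
    ∷ (ℕtoℚ 4 , - 1ℚ) ∷ (- 1ℚ , + 3 / 2) ∷ gridPt 4 4 ∷ [])

open SmallGrids

-- Assembly by parity.

even⊎odd : ∀ k → (∃ λ m′ → k ≡ m′ ℕ.+ m′) ⊎ (∃ λ m′ → k ≡ suc (m′ ℕ.+ m′))
even⊎odd zero = inj₁ (0 , refl)
even⊎odd (suc k) with even⊎odd k
... | inj₁ (m′ , refl) = inj₂ (m′ , refl)
... | inj₂ (m′ , refl) = inj₁ (suc m′ , cong suc (sym (ℕ.+-suc m′ m′)))

open import Data.Nat using (_≤_; _*_)

-- The claim as a predicate of `n`, so that it can be transported from the form of `n` in the
-- construction to the one obtained by pattern matching.
Solved : ℕ → Set
Solved n = (Σ (Chain (minTrailLength n)) λ v → IsCoveringPath v n)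
  × ((m : ℕ) → 1 ≤ m → n ≡ 2 * m → Σ (Chain (minTrailLength n)) λ v → IsCoveringCycle v n)

solved-odd : ∀ m′ → Solved (5 ℕ.+ (m′ ℕ.+ m′))
solved-odd m′ = subst Solved (cong (4 ℕ.+_) (ℕ.+-suc m′ m′))
  ((OddGrid.chain m′ , OddGrid.coveringPath m′) , λ m _ eq → contradiction (trans (sym eq) (odd m′)) (ℕ.even≢odd m (2 ℕ.+ m′)))
  where
  odd : ∀ k → 3 ℕ.+ (suc k ℕ.+ suc k) ≡ suc (2 * (2 ℕ.+ k))
  odd = ℕ-Ring.solve-∀

solved-even : ∀ m′ → Solved (6 ℕ.+ (m′ ℕ.+ m′))
solved-even m′ = subst Solved (cong (4 ℕ.+_) (trans (ℕ.+-suc m′ (suc m′)) (cong suc (ℕ.+-suc m′ m′))))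
  ((EvenGrid.chain m′ , EvenGrid.coveringPath m′) , λ _ _ _ → EvenGrid.chain m′ , EvenGrid.cycle m′)

theorem2p1 : (n : ℕ) → 1 ≤ n →
    (Σ (Chain (minTrailLength n)) λ v → IsCoveringPath v n)
    × ((m : ℕ) → 1 ≤ m → n ≡ 2 * m →
    Σ (Chain (minTrailLength n)) λ v → IsCoveringCycle v n)
theorem2p1 1 _ = (segment , toWitness {a? = isCoveringPath? segment 1} _) ,
  λ m _ eq → contradiction (sym eq) (ℕ.even≢odd m 0)
theorem2p1 2 _ = (triangle , toWitness {a? = isCoveringPath? triangle 2} _) ,
  λ _ _ _ → triangle , toWitness {a? = isCoveringCycle? triangle 2} _
theorem2p1 3 _ = (nineDots , toWitness {a? = isCoveringPath? nineDots 3} _) ,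
  λ m _ eq → contradiction (sym eq) (ℕ.even≢odd m 1)
theorem2p1 4 _ = (hexagram , toWitness {a? = isCoveringPath? hexagram 4} _) ,
  λ _ _ _ → hexagram , toWitness {a? = isCoveringCycle? hexagram 4} _
theorem2p1 (suc (suc (suc (suc (suc k))))) _ with even⊎odd k
... | inj₁ (m′ , refl) = solved-odd m′
... | inj₂ (m′ , refl) = solved-even m′
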